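{- Let $k$ be an odd positive integer and let $G$ be a multigraph with maximum degree $\Delta(G)$. Then $\bigl\lceil\frac{\Delta(G)}{k}\bigr\rceil\le\chi'_k(G)\le\mathit{ch}'_k(G)\le\bigl\lceil\frac{3\,\Delta(G)}{3k-1}\bigr\rceil$.
   Context: Multigraphs are finite, may have multiple edges, but have no loops. For an integer $k\ge1$, a $k$-frugal edge colouring of a multigraph $G$ is a (possibly improper) colouring of its edges such that no colour appears more than $k$ times on the edges incident with any vertex. $\chi'_k(G)$ is the least number of colours in a $k$-frugal edge colouring of $G$. $\mathit{ch}'_k(G)$ is the least $t$ such that whenever each edge $e$ is given a list $L(e)$ of $t$ colours, there is a $k$-frugal edge colouring of $G$ in which each edge $e$ receives a colour from $L(e)$. -}

module Defs where

open import Data.Nat using (ℕ; zero; suc; _+_; _*_; _∸_; _≤_; _⊔_; NonZero)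
open import Data.Nat.DivMod using (_/_)
open import Data.Fin using (Fin; zero; suc)
open import Data.Product using (Σ; _×_; _,_; proj₁; proj₂)
open import Data.Sum using (_⊎_)
open import Data.List using (List; length)
open import Data.List.Membership.Propositional using (_∈_)
open import Data.List.Relation.Unary.Unique.Propositional using (Unique)
open import Relation.Nullary using (¬_; Dec; yes; no)
open import Relation.Nullary.Decidable using (_⊎-dec_; _×-dec_)
open import Relation.Binary.PropositionalEquality using (_≡_)
open import Relation.Binary.Definitions using (DecidableEquality)
open import Data.Fin using (_≟_)

count : ∀ {n} {P : Fin n → Set} → (∀ i → Dec (P i)) → ℕ
count {zero} d = 0
count {suc n} d with d zero
... | yes _ = suc (count (λ i → d (suc i)))
... | no _ = count (λ i → d (suc i))

maxFin : ∀ {n} → (Fin n → ℕ) → ℕ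
maxFin {zero} f = 0
maxFin {suc n} f = f zero ⊔ maxFin (λ i → f (suc i))

⌈_/_⌉ : (a b : ℕ) → .{{NonZero b}} → ℕ
⌈ a / b ⌉ = (a + b ∸ 1) / b

record Multigraph : Set where
  field
    n m   : ℕ
    ends  : Fin m → Fin n × Fin n
    loopless : ∀ e → ¬ (proj₁ (ends e) ≡ proj₂ (ends e))

open Multigraph public

Incident : (G : Multigraph) → Fin (m G) → Fin (n G) → Set
Incident G e x = (proj₁ (ends G e) ≡ x) ⊎ (proj₂ (ends G e) ≡ x)

incident? : (G : Multigraph) → ∀ e x → Dec (Incident G e x)
incident? G e x = (proj₁ (ends G e) ≟ x) ⊎-dec (proj₂ (ends G e) ≟ x)

degree : (G : Multigraph) → Fin (n G) → ℕ
degree G x = count (λ e → incident? G e x)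

Δ : Multigraph → ℕ
Δ G = maxFin (degree G)

colourDegree : (G : Multigraph) {C : Set} → DecidableEquality C →
               (Fin (m G) → C) → Fin (n G) → C → ℕ
colourDegree G _≟C_ c x a = count (λ e → incident? G e x ×-dec (c e ≟C a))

Frugal : (G : Multigraph) (k : ℕ) {C : Set} → DecidableEquality C →
         (Fin (m G) → C) → Set
Frugal G k dec c = ∀ x a → colourDegree G dec c x a ≤ k

Colourable : Multigraph → (k t : ℕ) → Set
Colourable G k t = Σ (Fin (m G) → Fin t) (Frugal G k _≟_)

ListColourable : Multigraph → (k t : ℕ) → Set
ListColourable G k t =
  (L : Fin (m G) → List ℕ) →
  (∀ e → length (L e) ≡ t) → (∀ e → Unique (L e)) →
  Σ (Fin (m G) → ℕ) λ c → (∀ e → c e ∈ L e) × Frugal G k Data.Nat._≟_ c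

IsChromaticIndexₖ : Multigraph → (k χ : ℕ) → Set
IsChromaticIndexₖ G k χ = Colourable G k χ × (∀ t → Colourable G k t → χ ≤ t)

IsChoiceIndexₖ : Multigraph → (k ch : ℕ) → Set
IsChoiceIndexₖ G k ch = ListColourable G k ch × (∀ t → ListColourable G k t → ch ≤ t)

-- Let t = ⌈3Δ/(3k-1)⌉, k = 2p + 1 and d = Δ - 2pt, so that 3d ≤ 2t. Galvin's theorem holds with local
-- list sizes: a bipartite multigraph can be coloured from lists with |L(xy)| ≥ max(deg x, deg y)
-- (Borodin, Kostochka, Woodall). It yields Shannon's bound for lists: colour the edges inside the parts
-- of a maximum cut greedily and then the bipartite rest. The parity of Δ prevents removing a subgraph
-- of degree exactly 2pt, but the edges can be split into D of maximum degree at most 2pt + 1 and H of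
-- maximum degree at most d. A balanced orientation of D, with the out- and in-edges of every vertex cut
-- into p blocks of t edges, is coloured by Galvin's theorem; at most one edge per vertex is left over,
-- and only at vertices with degree less than d in H. These edges and H are coloured properly at every
-- vertex as in Shannon's bound, so each colour occurs at most p + p + 1 = k times.

module Submission where

open import Defs
open import Data.Nat
  using (ℕ; zero; suc; _+_; _*_; _∸_; _≤_; _<_; _⊔_; _%_; _^_; NonZero; z≤n; s≤s; s≤s⁻¹; _<?_; _≤?_)
import Data.Nat as ℕ
open import Data.Nat.Properties hiding (_≟_)
open import Data.Nat.DivMod using (_/_; m≡m%n+[m/n]*n; m/n*n≤m; m<n*o⇒m/o<n; m%n<n)
open import Data.Nat.Tactic.RingSolver using (solve-∀)
open import Data.Fin using (Fin; zero; suc; toℕ)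
import Data.Fin as Fin
import Data.Fin.Properties as Finₚ
open import Data.Fin.Properties using (any?; all?)
open import Data.Bool using (Bool; true; false; not; if_then_else_)
import Data.Bool.Properties as Boolₚ
open import Data.Product using (Σ; ∃; _×_; _,_; proj₁; proj₂; swap)
open import Data.Product.Properties using () renaming (≡-dec to ×-≡-dec)
open import Data.Sum using (_⊎_; inj₁; inj₂; [_,_]′)
import Data.Sum as Sum
open import Data.Unit using (tt)
open import Data.Empty using (⊥; ⊥-elim)
open import Data.List using (List; []; _∷_; length; filter; upTo; lookup; tabulate)
import Data.List.Properties as Listₚ
open import Data.List.Membership.DecPropositional ℕ._≟_ using () renaming (_∈?_ to _∈ˡ?_)
open import Data.List.Membership.Propositional using () renaming (_∈_ to _∈ˡ_)
open import Data.List.Membership.Propositional.Properties using (∈-filter⁻; ∈-upTo⁻; ∈-lookup; ∈-tabulate⁻)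
open import Data.List.Relation.Unary.Any using (here; there)
open import Data.List.Relation.Unary.All using (All; []; _∷_)
import Data.List.Relation.Unary.All as All
open import Data.List.Relation.Unary.AllPairs using ([]; _∷_)
open import Data.List.Relation.Unary.Unique.Propositional using (Unique)
import Data.List.Relation.Unary.Unique.Propositional.Properties as Uniqueₚ
open import Function using (_∘_; id)
open import Relation.Binary.Definitions using (DecidableEquality; tri<; tri≈; tri>)
open import Relation.Binary.PropositionalEquality
  using (_≡_; _≢_; refl; sym; trans; cong; cong₂; subst; subst₂; module ≡-Reasoning)
open import Relation.Nullary using (¬_; Dec; yes; no; contradiction)
open import Relation.Nullary.Decidable using (_×-dec_; _⊎-dec_; _→-dec_; ¬?; map′; toSum)

-- Since `t * (6 * p + 2)` is three times `p * t + p * t` plus `2 * t`, the bound on `t` turns into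
-- `3 * d ≤ 2 * t`. What is left over in `D` is an incidence rather than an edge: an edge beyond the
-- `p` blocks at one end may lie within them at the other, and it is coloured together with the rest
-- of `D`. Later edges avoid its colour at the first end only. If σ counts at each vertex the
-- leftover incidence and the edges inside the parts of the cut, then 2σ ≤ d + 1, and an edge vw
-- across the cut keeps at least t - σ(v) - σ(w) colours. This number depends on the edge, which is
-- why Galvin's theorem is needed with local list sizes. The classical preference order, read off
-- from an edge colouring, bounds the number of preferred neighbours of an edge only by the maximum
-- degree; here the order is built from matchings that are removed one by one. Finally, the two
-- indices have to be exhibited as least numbers, so both colouring properties must be shown
-- decidable.

-- Counting elements of `Fin n`

-- Since card does not reduce, unification can recover the predicate from a value of card.
abstract
  card : ∀ {n} {P : Fin n → Set} → (∀ i → Dec (P i)) → ℕ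
  card = count

  card≡count : ∀ {n} {P : Fin n → Set} (P? : ∀ i → Dec (P i)) → card P? ≡ count P?
  card≡count _ = refl

  card-none : ∀ {n} {P : Fin n → Set} {P? : ∀ i → Dec (P i)} → (∀ i → ¬ P i) → card P? ≡ 0
  card-none {zero} none = refl
  card-none {suc n} {P? = P?} none with P? zero
  ... | yes p = contradiction p (none zero)
  ... | no _ = card-none (none ∘ suc)

  card-mono : ∀ {n} {P Q : Fin n → Set} {P? : ∀ i → Dec (P i)} {Q? : ∀ i → Dec (Q i)} →
              (∀ i → P i → Q i) → card P? ≤ card Q?
  card-mono {zero} P⊆Q = z≤n
  card-mono {suc n} {P? = P?} {Q?} P⊆Q with P? zero | Q? zero
  ... | yes p | yes _ = s≤s (card-mono (P⊆Q ∘ suc))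
  ... | yes p | no ¬q = contradiction (P⊆Q zero p) ¬q
  ... | no _ | yes _ = m≤n⇒m≤1+n (card-mono (P⊆Q ∘ suc))
  ... | no _ | no _ = card-mono (P⊆Q ∘ suc)

  card-∪ : ∀ {n} {P Q R : Fin n → Set}
           {P? : ∀ i → Dec (P i)} {Q? : ∀ i → Dec (Q i)} {R? : ∀ i → Dec (R i)} →
           (∀ i → R i → P i ⊎ Q i) → card R? ≤ card P? + card Q?
  card-∪ {zero} R⊆P∪Q = z≤n
  card-∪ {suc n} {P? = P?} {Q?} {R?} R⊆P∪Q
    with ih ← card-∪ {P? = P? ∘ suc} {Q? ∘ suc} {R? ∘ suc} (R⊆P∪Q ∘ suc)
    with P? zero | Q? zero | R? zero
  ... | yes _ | yes _ | yes _ = s≤s (≤-trans ih (+-monoʳ-≤ _ (n≤1+n _)))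
  ... | yes _ | no _ | yes _ = s≤s ih
  ... | no _ | yes _ | yes _ = ≤-trans (s≤s ih) (≤-reflexive (sym (+-suc _ _)))
  ... | no ¬p | no ¬q | yes r = ⊥-elim ([ ¬p , ¬q ]′ (R⊆P∪Q zero r))
  ... | yes _ | yes _ | no _ = m≤n⇒m≤1+n (≤-trans ih (+-monoʳ-≤ _ (n≤1+n _)))
  ... | yes _ | no _ | no _ = m≤n⇒m≤1+n ih
  ... | no _ | yes _ | no _ = ≤-trans ih (+-monoʳ-≤ _ (n≤1+n _))
  ... | no _ | no _ | no _ = ih

  card-⊎ : ∀ {n} {P Q R : Fin n → Set}
           {P? : ∀ i → Dec (P i)} {Q? : ∀ i → Dec (Q i)} {R? : ∀ i → Dec (R i)} →
           (∀ i → P i → R i) → (∀ i → Q i → R i) → (∀ i → P i → ¬ Q i) →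
           card P? + card Q? ≤ card R?
  card-⊎ {zero} _ _ _ = z≤n
  card-⊎ {suc n} {P? = P?} {Q?} {R?} P⊆R Q⊆R disj
    with ih ← card-⊎ {P? = P? ∘ suc} {Q? ∘ suc} {R? ∘ suc} (P⊆R ∘ suc) (Q⊆R ∘ suc) (disj ∘ suc)
    with P? zero | Q? zero | R? zero
  ... | yes p | yes q | _ = contradiction q (disj zero p)
  ... | yes p | no _ | no ¬r = contradiction (P⊆R zero p) ¬r
  ... | no _ | yes q | no ¬r = contradiction (Q⊆R zero q) ¬r
  ... | yes _ | no _ | yes _ = s≤s ih
  ... | no _ | yes _ | yes _ = ≤-trans (≤-reflexive (+-suc _ _)) (s≤s ih)
  ... | no _ | no _ | yes _ = m≤n⇒m≤1+n ih
  ... | no _ | no _ | no _ = ih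

  card-pos : ∀ {n} {P : Fin n → Set} {P? : ∀ i → Dec (P i)} i → P i → 0 < card P?
  card-pos {suc n} {P? = P?} i p with P? zero | i
  ... | yes _ | _ = s≤s z≤n
  ... | no ¬p | zero = contradiction p ¬p
  ... | no _ | suc j = card-pos j p

  card-≤1 : ∀ {n} {P : Fin n → Set} {P? : ∀ i → Dec (P i)} →
            (∀ i j → P i → P j → i ≡ j) → card P? ≤ 1
  card-≤1 {zero} _ = z≤n
  card-≤1 {suc n} {P? = P?} unique with P? zero
  ... | yes p = s≤s (≤-reflexive (card-none {P? = P? ∘ suc} λ i q → Finₚ.0≢1+n (unique _ _ p q)))
  ... | no _ = card-≤1 {P? = P? ∘ suc} λ i j p q → Finₚ.suc-injective (unique _ _ p q)

card-cong : ∀ {n} {P Q : Fin n → Set} {P? : ∀ i → Dec (P i)} {Q? : ∀ i → Dec (Q i)} →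
            (∀ i → P i → Q i) → (∀ i → Q i → P i) → card P? ≡ card Q?
card-cong P⊆Q Q⊆P = ≤-antisym (card-mono P⊆Q) (card-mono Q⊆P)

card-< : ∀ {n} {P Q : Fin n → Set} {P? : ∀ i → Dec (P i)} {Q? : ∀ i → Dec (Q i)} →
         (∀ i → P i → Q i) → ∀ j → Q j → ¬ P j → card P? < card Q?
card-< {P = P} {Q} {P?} {Q?} P⊆Q j q ¬p = begin-strict
  card P?                <⟨ m<m+n _ (card-pos {P? = rest?} j (q , ¬p)) ⟩
  card P? + card rest?  ≤⟨ card-⊎ P⊆Q (λ _ → proj₁) (λ _ p r → proj₂ r p) ⟩
  card Q?                ∎
  where
  open ≤-Reasoning
  rest? : ∀ i → Dec (Q i × ¬ P i)
  rest? i = Q? i ×-dec ¬? (P? i)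

card-fibres : ∀ {n κ} B {P : Fin n → Set} {P? : ∀ i → Dec (P i)} (g : Fin n → ℕ) →
              (∀ i → P i → g i < B) → (∀ b → card (λ i → P? i ×-dec (g i ℕ.≟ b)) ≤ κ) →
              card P? ≤ B * κ
card-fibres zero g g<B _ = ≤-reflexive (card-none λ i p → contradiction (g<B i p) λ ())
card-fibres {κ = κ} (suc B) {P} {P?} g g<B fibre≤ = begin
  card P?                                                           ≤⟨ card-∪ split ⟩
  card (λ i → P? i ×-dec (g i ℕ.≟ B)) + card (λ i → P? i ×-dec (g i <? B))
    ≤⟨ +-mono-≤ (fibre≤ B) (card-fibres B g (λ _ → proj₂)
         λ b → ≤-trans (card-mono λ _ ((p , _) , e) → p , e) (fibre≤ b)) ⟩
  κ + B * κ                                                          ∎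
  where
  open ≤-Reasoning
  split : ∀ i → P i → (P i × g i ≡ B) ⊎ (P i × g i < B)
  split i p with g i ℕ.≟ B
  ... | yes e = inj₁ (p , e)
  ... | no ne = inj₂ (p , ≤∧≢⇒< (s≤s⁻¹ (g<B i p)) ne)

card-injective : ∀ {n} B {P : Fin n → Set} {P? : ∀ i → Dec (P i)} (g : Fin n → ℕ) →
                 (∀ i → P i → g i < B) → (∀ i j → P i → P j → g i ≡ g j → i ≡ j) →
                 card P? ≤ B
card-injective B g g<B inj = ≤-trans
  (card-fibres {κ = 1} B g g<B λ b → card-≤1
    λ i j (p , e) (q , e′) → inj i j p q (trans e (sym e′)))
  (≤-reflexive (*-identityʳ B))

-- Decidable sets

-- `Mem` is implicit in the constructor, so a set is written down as its decision procedure alone.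
record DSet (A : Set) : Set₁ where
  constructor ⟨_⟩
  field
    {Mem} : A → Set
    dec   : ∀ a → Dec (Mem a)

open DSet public

infix 4 _∈_ _∉_ _⊆_

_∈_ _∉_ : ∀ {A} → A → DSet A → Set
a ∈ R = Mem R a
a ∉ R = ¬ a ∈ R

_⊆_ : ∀ {A} → DSet A → DSet A → Set
R ⊆ S = ∀ a → a ∈ R → a ∈ S

infixl 6 _∖_ _∪_

_∖_ _∪_ : ∀ {A} → DSet A → DSet A → DSet A
R ∖ S = ⟨ (λ a → dec R a ×-dec ¬? (dec S a)) ⟩
R ∪ S = ⟨ (λ a → dec R a ⊎-dec dec S a) ⟩

# : ∀ {n} → DSet (Fin n) → ℕ
# R = card (dec R)

singleton : ∀ {n} → Fin n → DSet (Fin n)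
singleton e = ⟨ Fin._≟ e ⟩

∅ full : ∀ {A} → DSet A
∅ = ⟨ (λ _ → no id) ⟩
full = ⟨ (λ _ → yes tt) ⟩

#-∖ : ∀ {n} {R M : DSet (Fin n)} e → e ∈ R → e ∈ M → ∀ {b} → # R ≤ suc b → # (R ∖ M) ≤ b
#-∖ e r m #R≤ = s≤s⁻¹ (≤-trans (card-< (λ _ → proj₁) e r λ (_ , ¬m) → ¬m m) #R≤)

#-empty : ∀ {n} {R : DSet (Fin n)} → # R ≤ 0 → ∀ e → e ∉ R
#-empty #R≤0 e r = contradiction (≤-trans (card-pos e r) #R≤0) λ ()

-- Each rejected entry is charged to a member of `Q` of that colour; the entries of a `Unique` list
-- are different colours, so no member is charged twice.
filter-length : ∀ {n} {P : ℕ → Set} (P? : ∀ a → Dec (P a)) (Q : DSet (Fin n)) (c : Fin n → ℕ) {xs} →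
                Unique xs → (∀ a → ¬ P a → ∃ λ f → f ∈ Q × c f ≡ a) →
                length xs ≤ length (filter P? xs) + # Q
filter-length {n} {P} P? Q c {xs} uniq hit = go xs uniq Q λ a _ → hit a
  where
  go : ∀ xs → Unique xs → (Q : DSet (Fin n)) →
       (∀ a → a ∈ˡ xs → ¬ P a → ∃ λ f → f ∈ Q × c f ≡ a) →
       length xs ≤ length (filter P? xs) + # Q
  go [] _ Q _ = z≤n
  go (a ∷ xs) (a∉ ∷ uniq) Q hit with P? a
  ... | yes _ = s≤s (go xs uniq Q λ b b∈ → hit b (there b∈))
  ... | no ¬p with f , q , refl ← hit a (here refl) ¬p = begin
    suc (length xs)                            ≤⟨ s≤s (go xs uniq (Q ∖ singleton f) hit′) ⟩
    suc (length ys + # (Q ∖ singleton f))      ≡⟨ sym (+-suc _ _) ⟩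
    length ys + suc (# (Q ∖ singleton f))
      ≤⟨ +-monoʳ-≤ (length ys) (card-< (λ _ → proj₁) f q λ (_ , ne) → ne refl) ⟩
    length ys + # Q                            ∎
    where
    open ≤-Reasoning
    ys = filter P? xs
    hit′ : ∀ b → b ∈ˡ xs → ¬ P b → ∃ λ g → g ∈ (Q ∖ singleton f) × c g ≡ b
    hit′ b b∈ ¬pb with g , q′ , eq ← hit b (there b∈) ¬pb =
      g , (q′ , λ g≡f → All.lookup a∉ b∈ (trans (cong c (sym g≡f)) eq)) , eq

≤-maxFin : ∀ {n} (f : Fin n → ℕ) i → f i ≤ maxFin f
≤-maxFin f zero = m≤m⊔n _ _
≤-maxFin f (suc i) = ≤-trans (≤-maxFin (f ∘ suc) i) (m≤n⊔m _ _)

-- Galvin's theorem with local list sizes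

module Sides {m : ℕ} {V : Set} (_≟_ : DecidableEquality V) where

  -- A bipartite multigraph is a pair of maps from edges to `V`, one for each side. Equal values of
  -- different maps count as different vertices, so every oriented multigraph is an instance.
  InjectiveOn : {A : Set} → (Fin m → A) → DSet (Fin m) → Set
  InjectiveOn z M = ∀ e f → e ∈ M → f ∈ M → z e ≡ z f → e ≡ f

  deg : (Fin m → V) → DSet (Fin m) → V → ℕ
  deg z R v = card (λ f → dec R f ×-dec (z f ≟ v))

  before : (Fin m → V) → (Fin m → ℕ) → DSet (Fin m) → Fin m → ℕ
  before z p R e = card (λ f → dec R f ×-dec ((z f ≟ z e) ×-dec (p f <? p e)))

  -- p ranks the edges at each vertex z e, smaller ranks being preferred.
  Ranking : (Fin m → V) → (Fin m → ℕ) → DSet (Fin m) → Set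
  Ranking z p R = ∀ e f → e ∈ R → f ∈ R → z e ≡ z f → p e ≡ p f → e ≡ f

  Proper : {C : Set} → (Fin m → V) → DSet (Fin m) → (Fin m → C) → Set
  Proper z R c = ∀ e f → e ∈ R → f ∈ R → z e ≡ z f → c e ≡ c f → e ≡ f

  Ranking-⊆ : ∀ {z p R S} → S ⊆ R → Ranking z p R → Ranking z p S
  Ranking-⊆ S⊆R r e f e∈ f∈ = r e f (S⊆R e e∈) (S⊆R f f∈)

  -- A stable matching in the sense of Gale and Shapley: a kernel of the line graph of `S` in which
  -- each edge points to the edges preferred to it at either end.
  record Stable (x y : Fin m → V) (p q : Fin m → ℕ) (S M : DSet (Fin m)) : Set where
    field
      M⊆S : M ⊆ S
      inj-x : InjectiveOn x M
      inj-y : InjectiveOn y M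
      dominated : ∀ e → e ∈ S → e ∉ M →
                  ∃ λ f → f ∈ M × ((x f ≡ x e × p f < p e) ⊎ (y f ≡ y e × q f < q e))

  module _ (x y : Fin m → V) (p q : Fin m → ℕ) where

    Better : DSet (Fin m) → Fin m → Fin m → Set
    Better S e f = f ∈ S × x f ≡ x e × p f < p e

    better? : ∀ S e f → Dec (Better S e f)
    better? S e f = dec S f ×-dec ((x f ≟ x e) ×-dec (p f <? p e))

    favourites : DSet (Fin m) → DSet (Fin m)
    favourites S = ⟨ (λ e → dec S e ×-dec ¬? (any? (better? S e))) ⟩

    favourite : ∀ S b e → p e ≤ b → e ∈ S → ∃ λ f → f ∈ favourites S × x f ≡ x e × p f ≤ p e
    favourite S b e pe≤b e∈S with any? (better? S e)
    ... | no none = e , (e∈S , none) , refl , ≤-refl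
    favourite S zero e pe≤b e∈S | yes (g , g∈S , xg , pg<pe) =
      contradiction (≤-trans pg<pe pe≤b) λ ()
    favourite S (suc b) e pe≤b e∈S | yes (g , g∈S , xg , pg<pe)
      with f , f∈ , xf , pf≤pg ← favourite S b g (s≤s⁻¹ (≤-trans pg<pe pe≤b)) g∈S =
      f , f∈ , trans xf xg , ≤-trans pf≤pg (<⇒≤ pg<pe)

    -- If no favourite beats another edge on the y-side, the favourites form a stable matching;
    -- otherwise a beaten edge can be discarded.
    stable : ∀ b S → # S ≤ b → Ranking x p S → Ranking y q S → ∃ λ M → Stable x y p q S M
    stable zero S #S≤0 _ _ = ∅ , record
      { M⊆S = λ _ () ; inj-x = λ _ _ () ; inj-y = λ _ _ ()
      ; dominated = λ e e∈S → contradiction e∈S (#-empty {R = S} #S≤0 e) }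
    stable (suc b) S #S≤1+b rx ry
      with any? (λ e → any? (λ f → dec S e ×-dec (dec (favourites S) f ×-dec ((y f ≟ y e) ×-dec (q f <? q e)))))
    ... | no unbeaten = favourites S , record
      { M⊆S = λ _ → proj₁
      ; inj-x = fav-inj
      ; inj-y = λ e f e∈ f∈ ye≡yf → inj e f e∈ f∈ ye≡yf
      ; dominated = dom }
      where
      fav-inj : InjectiveOn x (favourites S)
      fav-inj e f (e∈ , e-best) (f∈ , f-best) xe≡xf = rx e f e∈ f∈ xe≡xf (≤-antisym
        (≮⇒≥ λ pf<pe → e-best (f , f∈ , sym xe≡xf , pf<pe))
        (≮⇒≥ λ pe<pf → f-best (e , e∈ , xe≡xf , pe<pf)))
      inj : InjectiveOn y (favourites S)
      inj e f e∈ f∈ ye≡yf = ry e f (proj₁ e∈) (proj₁ f∈) ye≡yf (≤-antisym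
        (≮⇒≥ λ qf<qe → unbeaten (e , f , proj₁ e∈ , f∈ , sym ye≡yf , qf<qe))
        (≮⇒≥ λ qe<qf → unbeaten (f , e , proj₁ f∈ , e∈ , ye≡yf , qe<qf)))
      dom : ∀ e → e ∈ S → e ∉ favourites S →
            ∃ λ f → f ∈ favourites S × ((x f ≡ x e × p f < p e) ⊎ (y f ≡ y e × q f < q e))
      dom e e∈S e∉ with any? (better? S e)
      ... | no none = contradiction (e∈S , none) e∉
      ... | yes (g , g∈S , xg , pg<pe) with f , f∈ , xf , pf≤pg ← favourite S (p g) g ≤-refl g∈S =
        f , f∈ , inj₁ (trans xf xg , ≤-<-trans pf≤pg pg<pe)
    ... | yes (e , f , e∈S , f∈F@(f∈S , f-best) , yf≡ye , qf<qe) = M , record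
      { M⊆S = λ g g∈M → proj₁ (M⊆S g g∈M)
      ; inj-x = inj-x
      ; inj-y = inj-y
      ; dominated = dom }
      where
      S′ = S ∖ singleton e
      IH = stable b S′ (#-∖ {R = S} {M = singleton e} e e∈S refl #S≤1+b)
             (Ranking-⊆ {R = S} {S = S′} (λ _ → proj₁) rx)
             (Ranking-⊆ {R = S} {S = S′} (λ _ → proj₁) ry)
      M = proj₁ IH
      open Stable (proj₂ IH)
      -- The favourite `f` that beats `e` is in `M` or dominated. No edge of `S` beats a favourite
      -- at its x-end, so a dominating edge beats `f` at the y-end and hence beats `e` as well.
      e-dom : ∃ λ g → g ∈ M × ((x g ≡ x e × p g < p e) ⊎ (y g ≡ y e × q g < q e))
      e-dom with dec M f
      ... | yes f∈M = f , f∈M , inj₂ (yf≡ye , qf<qe)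
      ... | no f∉M with dominated f (f∈S , λ { refl → <-irrefl refl qf<qe }) f∉M
      ... | g , g∈M , inj₁ (xg , pg<pf) =
        contradiction (g , proj₁ (M⊆S g g∈M) , xg , pg<pf) f-best
      ... | g , g∈M , inj₂ (yg , qg<qf) = g , g∈M , inj₂ (trans yg yf≡ye , <-trans qg<qf qf<qe)
      dom : ∀ g → g ∈ S → g ∉ M →
            ∃ λ h → h ∈ M × ((x h ≡ x g × p h < p g) ⊎ (y h ≡ y g × q h < q g))
      dom g g∈S g∉M with g Fin.≟ e
      ... | yes refl = e-dom
      ... | no g≢e = dominated g (g∈S , g≢e) g∉M

  -- The outdegree of `e` in the oriented line graph, where a parallel edge preferred at both ends
  -- counts twice.
  pre : (x y : Fin m → V) (p q : Fin m → ℕ) → DSet (Fin m) → Fin m → ℕ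
  pre x y p q R e = before x p R e + before y q R e

  -- The colours are used up one at a time: the edges that have a given colour in their lists
  -- contain a stable matching, and an edge outside it loses a predecessor with the colour.
  colour-by-ranking : ∀ x y p q b R (Λ : Fin m → List ℕ) → # R ≤ b →
    Ranking x p R → Ranking y q R → (∀ e → e ∈ R → Unique (Λ e)) →
    (∀ e → e ∈ R → pre x y p q R e < length (Λ e)) →
    ∃ λ c → (∀ e → e ∈ R → c e ∈ˡ Λ e) × Proper x R c × Proper y R c
  colour-by-ranking x y p q zero R Λ #R≤0 _ _ _ _ = (λ _ → 0) ,
    (λ e e∈ → contradiction e∈ (empty e)) ,
    (λ e _ e∈ → contradiction e∈ (empty e)) , λ e _ e∈ → contradiction e∈ (empty e)
    where
    empty = #-empty {R = R} #R≤0
  colour-by-ranking x y p q (suc b) R Λ #R≤1+b rx ry uniq enough with any? (dec R)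
  ... | no none = (λ _ → 0) ,
    (λ e e∈ → contradiction (e , e∈) none) ,
    (λ e _ e∈ → contradiction (e , e∈) none) , λ e _ e∈ → contradiction (e , e∈) none
  ... | yes (e₀ , e₀∈R) with Λ e₀ in Λe₀≡
  ... | [] = contradiction (enough e₀ e₀∈R) (subst (λ l → ¬ _ < length l) (sym Λe₀≡) λ ())
  ... | a ∷ _ = c , c∈Λ , proper x inj-x (proj₁ (proj₂ (proj₂ IH))) ,
                proper y inj-y (proj₂ (proj₂ (proj₂ IH)))
    where
    S : DSet (Fin m)
    S = ⟨ (λ e → dec R e ×-dec (a ∈ˡ? Λ e)) ⟩
    e₀∈S : e₀ ∈ S
    e₀∈S = e₀∈R , subst (a ∈ˡ_) (sym Λe₀≡) (here refl)
    st = stable x y p q (# S) S ≤-refl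
           (Ranking-⊆ {R = R} {S = S} (λ _ → proj₁) rx) (Ranking-⊆ {R = R} {S = S} (λ _ → proj₁) ry)
    M = proj₁ st
    open Stable (proj₂ st)
    M-nonempty : ∃ λ e → e ∈ M
    M-nonempty with dec M e₀
    ... | yes e₀∈M = e₀ , e₀∈M
    ... | no e₀∉M with f , f∈M , _ ← dominated e₀ e₀∈S e₀∉M = f , f∈M
    R′ = R ∖ M
    Λ′ : Fin m → List ℕ
    Λ′ e = filter (λ b → ¬? (b ℕ.≟ a)) (Λ e)
    before-≤ : ∀ z r e → before z r R′ e ≤ before z r R e
    before-≤ z r e = card-mono λ _ ((f∈R , _) , b) → f∈R , b
    before-< : ∀ z r e f → f ∈ M → z f ≡ z e → r f < r e → before z r R′ e < before z r R e
    before-< z r e f f∈M zf rf<re = card-< (λ _ ((f∈R , _) , b) → f∈R , b) f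
      (proj₁ (M⊆S f f∈M) , zf , rf<re) λ ((_ , f∉M) , _) → f∉M f∈M
    enough′ : ∀ e → e ∈ R′ → pre x y p q R′ e < length (Λ′ e)
    enough′ e (e∈R , e∉M) with a ∈ˡ? Λ e
    ... | no a∉Λ = <-≤-trans (≤-<-trans (+-mono-≤ (before-≤ x p e) (before-≤ y q e)) (enough e e∈R))
      (≤-reflexive (cong length (sym (Listₚ.filter-all (λ b → ¬? (b ℕ.≟ a)) {xs = Λ e}
        (All.tabulate λ { b∈Λ refl → a∉Λ b∈Λ })))))
    ... | yes a∈Λ = s≤s⁻¹ (begin
      suc (suc (pre x y p q R′ e))          ≤⟨ s≤s (fewer (dominated e (e∈R , a∈Λ) e∉M)) ⟩
      suc (pre x y p q R e)                 ≤⟨ enough e e∈R ⟩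
      -- A single witness suffices, because `a` is the only colour filtered out.
      length (Λ e)                          ≤⟨ filter-length _ (full {Fin 1}) (λ _ → a) (uniq e e∈R) hit ⟩
      length (Λ′ e) + # (full {Fin 1})      ≤⟨ +-monoʳ-≤ _ (card-≤1 λ { zero zero _ _ → refl }) ⟩
      length (Λ′ e) + 1                     ≡⟨ +-comm _ 1 ⟩
      suc (length (Λ′ e))                   ∎)
      where
      open ≤-Reasoning
      hit : ∀ b → ¬ ¬ b ≡ a → ∃ λ (f : Fin 1) → f ∈ (full {Fin 1}) × a ≡ b
      hit b ¬¬b≡a with b ℕ.≟ a
      ... | yes refl = zero , tt , refl
      ... | no b≢a = contradiction b≢a ¬¬b≡a
      fewer : (∃ λ f → f ∈ M × ((x f ≡ x e × p f < p e) ⊎ (y f ≡ y e × q f < q e))) →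
              pre x y p q R′ e < pre x y p q R e
      fewer (f , f∈M , inj₁ (xf , pf)) = +-mono-<-≤ (before-< x p e f f∈M xf pf) (before-≤ y q e)
      fewer (f , f∈M , inj₂ (yf , qf)) = +-mono-≤-< (before-≤ x p e) (before-< y q e f f∈M yf qf)
    IH = colour-by-ranking x y p q b R′ Λ′
           (#-∖ {R = R} {M} (proj₁ M-nonempty) (proj₁ (M⊆S _ (proj₂ M-nonempty))) (proj₂ M-nonempty) #R≤1+b)
           (Ranking-⊆ {R = R} {S = R′} (λ _ → proj₁) rx) (Ranking-⊆ {R = R} {S = R′} (λ _ → proj₁) ry)
           (λ e (e∈R , _) → Uniqueₚ.filter⁺ _ (uniq e e∈R)) enough′
    c′ = proj₁ IH
    c′∈Λ′ : ∀ e → e ∈ R → e ∉ M → c′ e ∈ˡ Λ e × c′ e ≢ a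
    c′∈Λ′ e e∈R e∉M = ∈-filter⁻ _ (proj₁ (proj₂ IH) e (e∈R , e∉M))
    c : Fin m → ℕ
    c e with dec M e
    ... | yes _ = a
    ... | no _ = c′ e
    c∈Λ : ∀ e → e ∈ R → c e ∈ˡ Λ e
    c∈Λ e e∈R with dec M e
    ... | yes e∈M = proj₂ (M⊆S e e∈M)
    ... | no e∉M = proj₁ (c′∈Λ′ e e∈R e∉M)
    proper : ∀ z → InjectiveOn z M → Proper z R′ c′ → Proper z R c
    proper z inj IHz e f e∈R f∈R ze≡zf ce≡cf with dec M e | dec M f
    ... | yes e∈M | yes f∈M = inj e f e∈M f∈M ze≡zf
    ... | yes e∈M | no f∉M = contradiction (sym ce≡cf) (proj₂ (c′∈Λ′ f f∈R f∉M))
    ... | no e∉M | yes f∈M = contradiction ce≡cf (proj₂ (c′∈Λ′ e e∈R e∉M))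
    ... | no e∉M | no f∉M = IHz e f (e∈R , e∉M) (f∈R , f∉M) ze≡zf ce≡cf

-- Augmenting paths and rankings with few predecessors

module Peeling {m : ℕ} {V : Set} (_≟_ : DecidableEquality V) where
  open Sides {m} _≟_

  Covers : (Fin m → V) → DSet (Fin m) → V → Set
  Covers z M v = ∃ λ e → e ∈ M × z e ≡ v

  covers? : ∀ z M v → Dec (Covers z M v)
  covers? z M v = any? (λ e → dec M e ×-dec (z e ≟ v))

  record IsMatching (x y : Fin m → V) (Γ M : DSet (Fin m)) : Set where
    field
      M⊆Γ : M ⊆ Γ
      inj-x : InjectiveOn x M
      inj-y : InjectiveOn y M

  module Augment (x y : Fin m → V) (Γ : DSet (Fin m)) where

    -- The covered y-side vertices grow by exactly `v`. Through `fixes`, a caller protects the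
    -- x-side vertices in `Z` from the path.
    record Augmented (Z : DSet V) (M : DSet (Fin m)) (v : V) (M′ : DSet (Fin m)) : Set where
      field
        matching : IsMatching x y Γ M′
        covers-v : Covers y M′ v
        keeps : ∀ f → f ∈ M → Covers y M′ (y f)
        adds-only : ∀ g → g ∈ M′ → y g ≡ v ⊎ Covers y M (y g)
        fixes : ∀ g → g ∈ M′ → x g ∈ Z → g ∈ M

    -- For `Z = ∅` this is a Hall violator: every vertex of `Z′` is matched, and `Z′` contains all
    -- neighbours of `v` and of the partners of its own vertices.
    record Closed (Z : DSet V) (M : DSet (Fin m)) (v : V) (Z′ : DSet V) : Set where
      field
        Z⊆Z′ : Z ⊆ Z′
        nbrs : ∀ g → g ∈ Γ → y g ≡ v → x g ∈ Z′
        closed : ∀ w → w ∈ Z′ → w ∉ Z →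
                 ∃ λ f → f ∈ M × x f ≡ w × (∀ g → g ∈ Γ → y g ≡ y f → x g ∈ Z′)

    -- The search is measured by edges, because `V` need not be finite.
    outside : DSet V → DSet (Fin m)
    outside Z = ⟨ (λ e → ¬? (dec Z (x e))) ⟩

    insert : ∀ {M} g → g ∈ Γ → IsMatching x y Γ M → ¬ Covers x M (x g) → ¬ Covers y M (y g) →
             IsMatching x y Γ (M ∪ singleton g)
    insert {M} g g∈Γ mat ¬x ¬y = record
      { M⊆Γ = λ { f (inj₁ f∈M) → M⊆Γ f f∈M ; f (inj₂ refl) → g∈Γ }
      ; inj-x = inj x inj-x ¬x ; inj-y = inj y inj-y ¬y }
      where
      open IsMatching mat
      inj : ∀ z → InjectiveOn z M → ¬ Covers z M (z g) → InjectiveOn z (M ∪ singleton g)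
      inj z iz ¬z e f (inj₁ e∈) (inj₁ f∈) eq = iz e f e∈ f∈ eq
      inj z iz ¬z e f (inj₁ e∈) (inj₂ refl) eq = contradiction (e , e∈ , eq) ¬z
      inj z iz ¬z e f (inj₂ refl) (inj₁ f∈) eq = contradiction (f , f∈ , sym eq) ¬z
      inj z iz ¬z e f (inj₂ refl) (inj₂ refl) eq = refl

    -- Depth-first search for an augmenting path from v that avoids Z; when it fails, the visited
    -- x-side vertices Z′ are matched, and their partners have no neighbours outside Z′.
    augment : ∀ b Z M v → # (outside Z) ≤ b → IsMatching x y Γ M → ¬ Covers y M v →
              ∃ (Augmented Z M v) ⊎ ∃ (Closed Z M v)
    augment zero Z M v #≤0 mat ¬v = inj₂ (Z , record
      { Z⊆Z′ = λ _ w∈Z → w∈Z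
      ; nbrs = λ g _ _ → in-Z g
      ; closed = λ w w∈ w∉ → contradiction w∈ w∉ })
      where
      in-Z : ∀ g → x g ∈ Z
      in-Z g with dec Z (x g)
      ... | yes z = z
      ... | no ¬z = contradiction ¬z (#-empty {R = outside Z} #≤0 g)
    augment (suc b) Z M v #≤ mat ¬v
      with any? (λ g → dec Γ g ×-dec ((y g ≟ v) ×-dec ¬? (dec Z (x g))))
    ... | no none = inj₂ (Z , record
      { Z⊆Z′ = λ _ w∈Z → w∈Z
      ; nbrs = nbrs
      ; closed = λ w w∈ w∉ → contradiction w∈ w∉ })
      where
      nbrs : ∀ g → g ∈ Γ → y g ≡ v → x g ∈ Z
      nbrs g g∈Γ yg with dec Z (x g)
      ... | yes z = z
      ... | no ¬z = contradiction (g , g∈Γ , yg , ¬z) none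
    ... | yes (g , g∈Γ , refl , xg∉Z) with covers? x M (x g)
    ... | no ¬xg = inj₁ (M ∪ singleton g , record
      { matching = insert {M} g g∈Γ mat ¬xg ¬v
      ; covers-v = g , inj₂ refl , refl
      ; keeps = λ f f∈M → f , inj₁ f∈M , refl
      ; adds-only = λ { h (inj₁ h∈M) → inj₂ (h , h∈M , refl) ; h (inj₂ refl) → inj₁ refl }
      ; fixes = λ { h (inj₁ h∈M) _ → h∈M ; h (inj₂ refl) xg∈Z → contradiction xg∈Z xg∉Z } })
    ... | yes (f , f∈M , xf≡xg) = step
      where
      open IsMatching mat
      -- The neighbour `x g` is marked as visited and its matching edge `f` is taken out, so that
      -- the search can go on from the partner `y f`.
      Z₁ : DSet V
      Z₁ = ⟨ (λ w → dec Z w ⊎-dec (w ≟ x g)) ⟩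
      M₁ = M ∖ singleton f
      #-shrinks : ∀ Z′ → Z₁ ⊆ Z′ → # (outside Z′) ≤ b
      #-shrinks Z′ Z₁⊆Z′ = s≤s⁻¹ (≤-trans
        (card-< (λ e ∉Z′ ∈Z → ∉Z′ (Z₁⊆Z′ _ (inj₁ ∈Z))) g xg∉Z λ ∉Z′ → ∉Z′ (Z₁⊆Z′ _ (inj₂ refl))) #≤)
      mat₁ : IsMatching x y Γ M₁
      mat₁ = record
        { M⊆Γ = λ e e∈ → M⊆Γ e (proj₁ e∈)
        ; inj-x = λ e h e∈ h∈ → inj-x e h (proj₁ e∈) (proj₁ h∈)
        ; inj-y = λ e h e∈ h∈ → inj-y e h (proj₁ e∈) (proj₁ h∈) }
      ¬yf : ¬ Covers y M₁ (y f)
      ¬yf (h , (h∈M , h≢f) , yh≡yf) = h≢f (inj-y h f h∈M f∈M yh≡yf)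
      rematch : ∃ (Augmented Z₁ M₁ (y f)) → ∃ (Augmented Z M (y g))
      rematch (M′ , aug) = M′ ∪ singleton g , record
        { matching = insert {M′} g g∈Γ matching ¬xg ¬yg
        ; covers-v = g , inj₂ refl , refl
        ; keeps = keeps′
        ; adds-only = adds-only′
        ; fixes = λ { h (inj₁ h∈M′) xh∈Z → proj₁ (fixes h h∈M′ (inj₁ xh∈Z))
                    ; h (inj₂ refl) xg∈Z → contradiction xg∈Z xg∉Z } }
        where
        open Augmented aug
        -- As `x g` lies in `Z₁`, an edge of `M′` at it would be in `M₁`; but the only edge of `M`
        -- there was `f`.
        ¬xg : ¬ Covers x M′ (x g)
        ¬xg (h , h∈M′ , xh≡xg) with h∈M , h≢f ← fixes h h∈M′ (inj₂ xh≡xg) =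
          h≢f (inj-x h f h∈M f∈M (trans xh≡xg (sym xf≡xg)))
        ¬yg : ¬ Covers y M′ (y g)
        ¬yg (h , h∈M′ , yh≡yg) with adds-only h h∈M′
        ... | inj₁ yh≡yf = ¬v (f , f∈M , trans (sym yh≡yf) yh≡yg)
        ... | inj₂ (k , (k∈M , _) , yk≡yh) = ¬v (k , k∈M , trans yk≡yh yh≡yg)
        lift : ∀ {w} → Covers y M′ w → Covers y (M′ ∪ singleton g) w
        lift (h , h∈ , yh) = h , inj₁ h∈ , yh
        keeps′ : ∀ h → h ∈ M → Covers y (M′ ∪ singleton g) (y h)
        keeps′ h h∈M with h Fin.≟ f
        ... | yes refl = lift covers-v
        ... | no h≢f = lift (keeps h (h∈M , h≢f))
        adds-only′ : ∀ h → h ∈ (M′ ∪ singleton g) → y h ≡ y g ⊎ Covers y M (y h)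
        adds-only′ h (inj₂ refl) = inj₁ refl
        adds-only′ h (inj₁ h∈M′) with adds-only h h∈M′
        ... | inj₁ yh≡yf = inj₂ (f , f∈M , sym yh≡yf)
        ... | inj₂ (k , (k∈M , _) , yk≡yh) = inj₂ (k , k∈M , yk≡yh)
      -- After a dead end at `y f` the other neighbours of `y g` are tried with the original `M`,
      -- and everything visited stays excluded.
      continue : ∃ (Closed Z₁ M₁ (y f)) → ∃ (Augmented Z M (y g)) ⊎ ∃ (Closed Z M (y g))
      continue (Z₂ , cl) = Sum.map restrict extend (augment b Z₂ M (y g) (#-shrinks Z₂ C₁.Z⊆Z′) mat ¬v)
        where
        module C₁ = Closed cl
        restrict : ∃ (Augmented Z₂ M (y g)) → ∃ (Augmented Z M (y g))
        restrict (M′ , aug) = M′ , record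
          { matching = matching ; covers-v = covers-v ; keeps = keeps ; adds-only = adds-only
          ; fixes = λ h h∈M′ xh∈Z → fixes h h∈M′ (C₁.Z⊆Z′ _ (inj₁ xh∈Z)) }
          where open Augmented aug
        extend : ∃ (Closed Z₂ M (y g)) → ∃ (Closed Z M (y g))
        extend (Z₃ , cl′) = Z₃ , record
          { Z⊆Z′ = λ w w∈Z → C₂.Z⊆Z′ w (C₁.Z⊆Z′ w (inj₁ w∈Z)) ; nbrs = C₂.nbrs ; closed = closed′ }
          where
          module C₂ = Closed cl′
          closed′ : ∀ w → w ∈ Z₃ → w ∉ Z →
                    ∃ λ h → h ∈ M × x h ≡ w × (∀ k → k ∈ Γ → y k ≡ y h → x k ∈ Z₃)
          closed′ w w∈Z₃ w∉Z with dec Z₂ w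
          ... | no w∉Z₂ = C₂.closed w w∈Z₃ w∉Z₂
          ... | yes w∈Z₂ with w ≟ x g
          ... | yes refl = f , f∈M , xf≡xg , λ k k∈Γ yk → C₂.Z⊆Z′ _ (C₁.nbrs k k∈Γ yk)
          ... | no w≢xg
            with h , (h∈M , _) , xh , near ← C₁.closed w w∈Z₂ [ w∉Z , w≢xg ]′ =
            h , h∈M , xh , λ k k∈Γ yk → C₂.Z⊆Z′ _ (near k k∈Γ yk)
      step : ∃ (Augmented Z M (y g)) ⊎ ∃ (Closed Z M (y g))
      step = [ inj₁ ∘ rematch , continue ]′ (augment b Z₁ M₁ (y f) (#-shrinks Z₁ λ _ z → z) mat₁ ¬yf)

  -- `pre<` is the local bound: it involves only the degrees at the two ends of `e`, so lists of
  -- that size exceed the outdegrees.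
  record Rankings (x y : Fin m → V) (R : DSet (Fin m)) : Set where
    field
      p q : Fin m → ℕ
      ranking-x : Ranking x p R
      ranking-y : Ranking y q R
      pre< : ∀ e → e ∈ R → pre x y p q R e < deg x R (x e) ⊔ deg y R (y e)

  -- M can be ranked first on the x-side and last on the y-side: its edges then have few enough
  -- predecessors, and whenever some other edge e is preceded by an edge of M, the larger of the
  -- two end degrees of e drops on removing M.
  record Peel (x y : Fin m → V) (R M : DSet (Fin m)) : Set where
    field
      M⊆R : M ⊆ R
      inj-x : InjectiveOn x M
      inj-y : InjectiveOn y M
      nonempty : ∃ λ e → e ∈ M
      drops : ∀ e f → e ∈ M → f ∈ R → x f ≡ x e →
              Covers y M (y f) ⊎ deg y R (y f) < deg x R (x e)

  swap-rankings : ∀ {x y R} → Rankings x y R → Rankings y x R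
  swap-rankings {x} {y} {R} r = record
    { p = q ; q = p ; ranking-x = ranking-y ; ranking-y = ranking-x
    ; pre< = λ e e∈ → subst (_< deg y R (y e) ⊔ deg x R (x e)) (+-comm (before x p R e) _)
        (subst (pre x y p q R e <_) (⊔-comm (deg x R (x e)) _) (pre< e e∈)) }
    where open Rankings r

  bound : (Fin m → ℕ) → ℕ
  bound q = suc (maxFin q)

  unpeel : ∀ {x y R M} → Peel x y R M → Rankings x y (R ∖ M) → Rankings x y R
  unpeel {x} {y} {R} {M} pl r = record
    { p = p′ ; q = q′ ; ranking-x = rx ; ranking-y = ry ; pre< = pre<′ }
    where
    open Peel pl
    open Rankings r
    p′ q′ : Fin m → ℕ
    p′ e with dec M e
    ... | yes _ = 0
    ... | no _ = suc (p e)
    q′ e with dec M e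
    ... | yes _ = bound q
    ... | no _ = q e
    rx : Ranking x p′ R
    rx e f e∈ f∈ xe≡xf p≡ with dec M e | dec M f
    ... | yes e∈M | yes f∈M = inj-x e f e∈M f∈M xe≡xf
    ... | no e∉M | no f∉M = ranking-x e f (e∈ , e∉M) (f∈ , f∉M) xe≡xf (suc-injective p≡)
    ry : Ranking y q′ R
    ry e f e∈ f∈ ye≡yf q≡ with dec M e | dec M f
    ... | yes e∈M | yes f∈M = inj-y e f e∈M f∈M ye≡yf
    ... | no e∉M | no f∉M = ranking-y e f (e∈ , e∉M) (f∈ , f∉M) ye≡yf q≡
    ... | yes _ | no _ = contradiction (≤-reflexive q≡) (<⇒≱ (s≤s (≤-maxFin q f)))
    ... | no _ | yes _ = contradiction (≤-reflexive (sym q≡)) (<⇒≱ (s≤s (≤-maxFin q e)))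
    deg-≤ : ∀ z v → deg z (R ∖ M) v ≤ deg z R v
    deg-≤ z v = card-mono λ _ ((f∈R , _) , zf) → f∈R , zf
    deg-< : ∀ z v → Covers z M v → deg z (R ∖ M) v < deg z R v
    deg-< z v (e , e∈M , ze) = card-< (λ _ ((f∈R , _) , zf) → f∈R , zf) e (M⊆R e e∈M , ze)
      λ ((_ , e∉M) , _) → e∉M e∈M
    below-y : ∀ e f → e ∉ M → q′ f < q′ e → f ∉ M × q f < q e
    below-y e f e∉M q< with dec M e | dec M f
    ... | yes e∈M | _ = contradiction e∈M e∉M
    ... | no _ | yes _ = contradiction (<⇒≤ q<) (<⇒≱ (s≤s (≤-maxFin q e)))
    ... | no _ | no f∉M = f∉M , q<
    below-x : ∀ e f → e ∉ M → p′ f < p′ e → (f ∉ M × p f < p e) ⊎ f ∈ M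
    below-x e f e∉M p< with dec M e | dec M f
    ... | yes e∈M | _ = contradiction e∈M e∉M
    ... | no _ | yes f∈M = inj₂ f∈M
    ... | no _ | no f∉M = inj₁ (f∉M , s≤s⁻¹ p<)
    not-first : ∀ e f → e ∈ M → ¬ p′ f < p′ e
    not-first e f e∈M p< with dec M e
    ... | yes _ = contradiction p< λ ()
    ... | no e∉M = e∉M e∈M
    before-y : ∀ e → e ∉ M → before y q′ R e ≤ before y q (R ∖ M) e
    before-y e e∉M = card-mono λ f (f∈R , yf , q<) →
      (f∈R , proj₁ (below-y e f e∉M q<)) , yf , proj₂ (below-y e f e∉M q<)
    hits : Fin m → DSet (Fin m)
    hits e = ⟨ (λ f → dec M f ×-dec (x f ≟ x e)) ⟩
    before-x : ∀ e → e ∉ M → before x p′ R e ≤ before x p (R ∖ M) e + # (hits e)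
    before-x e e∉M = card-∪ λ f (f∈R , xf , p<) →
      Sum.map (λ (f∉M , p<′) → (f∈R , f∉M) , xf , p<′) (λ f∈M → f∈M , xf) (below-x e f e∉M p<)
    pre<-first : ∀ e → e ∈ R → e ∈ M → pre x y p′ q′ R e < deg x R (x e) ⊔ deg y R (y e)
    pre<-first e e∈R e∈M = begin-strict
      before x p′ R e + before y q′ R e
        ≡⟨ cong (_+ before y q′ R e) (card-none λ f (_ , _ , p<) → not-first e f e∈M p<) ⟩
      before y q′ R e                     <⟨ card-< (λ f (f∈R , yf , _) → f∈R , yf) e (e∈R , refl)
                                               (λ (_ , _ , q<) → <-irrefl refl q<) ⟩
      deg y R (y e)                       ≤⟨ m≤n⊔m _ _ ⟩
      deg x R (x e) ⊔ deg y R (y e)       ∎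
      where open ≤-Reasoning
    pre<-later : ∀ e → e ∈ R → e ∉ M → pre x y p′ q′ R e < deg x R (x e) ⊔ deg y R (y e)
    pre<-later e e∈R e∉M with covers? x M (x e)
    ... | no ¬xe = begin-strict
      before x p′ R e + before y q′ R e   ≤⟨ +-mono-≤ (before-x e e∉M) (before-y e e∉M) ⟩
      before x p R′ e + # (hits e) + before y q R′ e
        ≡⟨ cong (λ h → before x p R′ e + h + before y q R′ e)
             (card-none λ f (f∈M , xf) → ¬xe (f , f∈M , xf)) ⟩
      before x p R′ e + 0 + before y q R′ e
        ≡⟨ cong (_+ before y q R′ e) (+-identityʳ _) ⟩
      pre x y p q R′ e                    <⟨ pre< e (e∈R , e∉M) ⟩
      deg x R′ (x e) ⊔ deg y R′ (y e)     ≤⟨ ⊔-mono-≤ (deg-≤ x (x e)) (deg-≤ y (y e)) ⟩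
      deg x R (x e) ⊔ deg y R (y e)       ∎
      where
      open ≤-Reasoning
      R′ = R ∖ M
    ... | yes (h , h∈M , xh≡xe) = begin-strict
      before x p′ R e + before y q′ R e   ≤⟨ +-mono-≤ (before-x e e∉M) (before-y e e∉M) ⟩
      before x p R′ e + # (hits e) + before y q R′ e
        ≤⟨ +-monoˡ-≤ (before y q R′ e) (+-monoʳ-≤ (before x p R′ e) (card-≤1 λ f g (f∈M , xf) (g∈M , xg) →
             inj-x f g f∈M g∈M (trans xf (sym xg)))) ⟩
      before x p R′ e + 1 + before y q R′ e
        ≡⟨ cong (_+ before y q R′ e) (+-comm _ 1) ⟩
      suc (pre x y p q R′ e)              ≤⟨ pre< e (e∈R , e∉M) ⟩
      deg x R′ (x e) ⊔ deg y R′ (y e)     <⟨ ⊔-lub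
        (<-≤-trans (deg-< x (x e) (h , h∈M , xh≡xe)) (m≤m⊔n _ _)) y-drop ⟩
      deg x R (x e) ⊔ deg y R (y e)       ∎
      where
      open ≤-Reasoning
      R′ = R ∖ M
      y-drop : deg y R′ (y e) < deg x R (x e) ⊔ deg y R (y e)
      -- Either `y e` loses an edge of `M` too, or its degree was below that of `x e` from the
      -- start.
      y-drop with drops h e h∈M e∈R (sym xh≡xe)
      ... | inj₁ cov = <-≤-trans (deg-< y (y e) cov) (m≤n⊔m _ _)
      ... | inj₂ d< = <-≤-trans (≤-<-trans (deg-≤ y (y e))
                        (subst (λ v → deg y R (y e) < deg x R v) xh≡xe d<)) (m≤m⊔n _ _)
    pre<′ : ∀ e → e ∈ R → pre x y p′ q′ R e < deg x R (x e) ⊔ deg y R (y e)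
    pre<′ e e∈R = [ pre<-first e e∈R , pre<-later e e∈R ]′ (toSum (dec M e))

  -- If `x e` has larger degree than all its neighbours, it determines the larger end degree of
  -- every edge at it, and removing `e` lowers that degree.
  singleton-peel : ∀ {x y R} e → e ∈ R →
                   (∀ f → f ∈ R → x f ≡ x e → deg y R (y f) < deg x R (x e)) → Peel x y R (singleton e)
  singleton-peel e e∈R drop = record
    { M⊆R = λ { f refl → e∈R }
    ; inj-x = λ { f g refl refl _ → refl }
    ; inj-y = λ { f g refl refl _ → refl }
    ; nonempty = e , refl
    ; drops = λ { f g refl g∈R xg → inj₂ (drop g g∈R xg) } }

  module _ (x y : Fin m → V) (R : DSet (Fin m)) (D : ℕ)
           (deg-x : ∀ e → e ∈ R → deg x R (x e) ≤ D) (deg-y : ∀ e → e ∈ R → deg y R (y e) ≤ D) where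

    top : DSet (Fin m)
    top = ⟨ (λ e → dec R e ×-dec ((deg x R (x e) ℕ.≟ D) ×-dec (deg y R (y e) ℕ.≟ D))) ⟩

    open Augment x y top

    uncovered : DSet (Fin m) → DSet (Fin m)
    uncovered M = ⟨ (λ e → dec R e ×-dec ((deg y R (y e) ℕ.≟ D) ×-dec ¬? (covers? y M (y e)))) ⟩

    -- Either the y-side vertices of degree D are all matched by top edges, or the search from
    -- an unmatched one gets stuck; both give a peelable matching.
    grow : ∀ b M → # (uncovered M) ≤ b → IsMatching x y top M → ∀ e₀ → e₀ ∈ R → deg x R (x e₀) ≡ D →
           ∃ λ M′ → Peel x y R M′ ⊎ Peel y x R M′
    grow b M #≤b mat e₀ e₀∈R xe₀ with any? (dec (uncovered M))
    ... | no none with any? (dec M)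
    ... | yes M≠∅ = M , inj₁ (record
      { M⊆R = λ e e∈M → proj₁ (M⊆Γ e e∈M) ; inj-x = inj-x ; inj-y = inj-y ; nonempty = M≠∅
      ; drops = drops })
      where
      open IsMatching mat
      drops : ∀ e f → e ∈ M → f ∈ R → x f ≡ x e → Covers y M (y f) ⊎ deg y R (y f) < deg x R (x e)
      drops e f e∈M f∈R _ with covers? y M (y f)
      ... | yes cov = inj₁ cov
      ... | no ¬cov = inj₂ (<-≤-trans (≤∧≢⇒< (deg-y f f∈R) λ d≡D → none (f , f∈R , d≡D , ¬cov))
                             (≤-reflexive (sym (proj₁ (proj₂ (M⊆Γ e e∈M))))))
    -- With `M` empty, no y-side vertex has degree `D`, so all neighbours of `x e₀` have smaller
    -- degree.
    ... | no M≡∅ = singleton e₀ , inj₁ (singleton-peel {x} {y} {R} e₀ e₀∈R λ f f∈R _ →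
      <-≤-trans (≤∧≢⇒< (deg-y f f∈R) λ d≡D → none (f , f∈R , d≡D , λ (g , g∈M , _) → M≡∅ (g , g∈M)))
        (≤-reflexive (sym xe₀)))
    grow zero M #≤0 mat e₀ e₀∈R xe₀ | yes (e , e∈) = contradiction e∈ (#-empty {R = uncovered M} #≤0 e)
    grow (suc b) M #≤b mat e₀ e₀∈R xe₀ | yes (e , e∈R , ye , ¬cov)
      with augment _ ∅ M (y e) ≤-refl mat ¬cov
    ... | inj₁ (M′ , aug) = grow b M′ (s≤s⁻¹ (≤-trans
        (card-< (λ f (f∈R , yf , ¬c) → f∈R , yf , λ (g , g∈M , yg) →
                   ¬c (subst (Covers y M′) yg (keeps g g∈M)))
                e (e∈R , ye , ¬cov) λ (_ , _ , ¬c) → ¬c covers-v) #≤b))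
        matching e₀ e₀∈R xe₀
      where open Augmented aug
    ... | inj₂ (Z , cl) with any? (λ f → dec M f ×-dec dec Z (x f))
    ... | yes K≠∅ = K , inj₂ (record
      { M⊆R = λ f (f∈M , _) → proj₁ (M⊆Γ f f∈M)
      ; inj-x = λ f g (f∈M , _) (g∈M , _) → inj-y f g f∈M g∈M
      ; inj-y = λ f g (f∈M , _) (g∈M , _) → inj-x f g f∈M g∈M
      ; nonempty = K≠∅
      ; drops = drops })
      where
      open IsMatching mat
      open Closed cl
      -- The part of `M` at visited x-side vertices, to be peeled with the sides exchanged: every
      -- neighbour of degree `D` of a y-end of `K` lies in `Z` again and is covered by `K`.
      K : DSet (Fin m)
      K = ⟨ (λ f → dec M f ×-dec dec Z (x f)) ⟩
      drops : ∀ f g → f ∈ K → g ∈ R → y g ≡ y f → Covers x K (x g) ⊎ deg x R (x g) < deg y R (y f)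
      drops f g (f∈M , xf∈Z) g∈R yg≡yf with deg x R (x g) ℕ.≟ D
      ... | no d≢D = inj₂ (<-≤-trans (≤∧≢⇒< (deg-x g g∈R) d≢D)
                            (≤-reflexive (sym (proj₂ (proj₂ (M⊆Γ f f∈M))))))
      ... | yes d≡D
        with f′ , f′∈M , xf′ , near ← closed (x f) xf∈Z id
        with refl ← inj-x f′ f f′∈M f∈M xf′
        with xg∈Z ← near g (g∈R , d≡D ,
               trans (cong (deg y R) yg≡yf) (proj₂ (proj₂ (M⊆Γ f f∈M)))) yg≡yf
        with h , h∈M , xh , _ ← closed (x g) xg∈Z id =
        inj₁ (h , (h∈M , subst (_∈ Z) (sym xh) xg∈Z) , xh)
    -- All vertices of `Z` are matched, so `Z` contains no end of an edge, and every neighbour of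
    -- the unmatched `y e` has degree below `D`.
    ... | no K≡∅ = singleton e , inj₂ (singleton-peel {y} {x} {R} e e∈R drop)
      where
      open Closed cl
      drop : ∀ g → g ∈ R → y g ≡ y e → deg x R (x g) < deg y R (y e)
      drop g g∈R yg≡ye = <-≤-trans (≤∧≢⇒< (deg-x g g∈R) λ d≡D → stuck
          (nbrs g (g∈R , d≡D , trans (cong (deg y R) yg≡ye) ye) yg≡ye))
          (≤-reflexive (sym ye))
        where
        stuck : ¬ x g ∈ Z
        stuck xg∈Z with h , h∈M , xh , _ ← closed (x g) xg∈Z id =
          K≡∅ (h , h∈M , subst (_∈ Z) (sym xh) xg∈Z)

    peel-at : ∀ e₀ → e₀ ∈ R → deg x R (x e₀) ≡ D → ∃ λ M′ → Peel x y R M′ ⊎ Peel y x R M′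
    peel-at = grow _ ∅ ≤-refl (record { M⊆Γ = λ _ () ; inj-x = λ _ _ () ; inj-y = λ _ _ () })

  maximal : ∀ (R : DSet (Fin m)) (h : Fin m → ℕ) → (∃ λ e → e ∈ R) →
            ∃ λ e → e ∈ R × (∀ f → f ∈ R → h f ≤ h e)
  maximal R h (e₀ , e₀∈R) = go (maxFin h) e₀ e₀∈R (m≤m+n _ _)
    where
    go : ∀ b e → e ∈ R → maxFin h ≤ b + h e → ∃ λ e → e ∈ R × (∀ f → f ∈ R → h f ≤ h e)
    go b e e∈R ≤b with any? (λ f → dec R f ×-dec (h e <? h f))
    ... | no none = e , e∈R , λ f f∈R → ≮⇒≥ λ h< → none (f , f∈R , h<)
    go zero e e∈R ≤b | yes (f , f∈R , h<) = contradiction (≤-trans (≤-maxFin h f) ≤b) (<⇒≱ h<)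
    go (suc b) e e∈R ≤b | yes (f , f∈R , h<) = go b f f∈R
      (≤-trans ≤b (≤-trans (≤-reflexive (sym (+-suc b _))) (+-monoʳ-≤ b h<)))

  -- `D` is the largest end degree over all edges of `R`; exchanging the sides if necessary, it is
  -- attained on the x-side.
  peelable : ∀ x y R → (∃ λ e → e ∈ R) → ∃ λ M → Peel x y R M ⊎ Peel y x R M
  peelable x y R R≠∅
    with e , e∈R , max ← maximal R (λ e → deg x R (x e) ⊔ deg y R (y e)) R≠∅
    with ⊔-sel (deg x R (x e)) (deg y R (y e))
  ... | inj₁ D≡ = peel-at x y R _ (λ f f∈R → m⊔n≤o⇒m≤o _ _ (max f f∈R))
                    (λ f f∈R → m⊔n≤o⇒n≤o _ _ (max f f∈R)) e e∈R (sym D≡)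
  ... | inj₂ D≡ with M , pl ← peel-at y x R _ (λ f f∈R → m⊔n≤o⇒n≤o _ _ (max f f∈R))
                    (λ f f∈R → m⊔n≤o⇒m≤o _ _ (max f f∈R)) e e∈R (sym D≡) = M , Sum.swap pl

  rankings : ∀ b x y R → # R ≤ b → Rankings x y R
  rankings b x y R #R≤b with any? (dec R)
  ... | no none = record
    { p = λ _ → 0 ; q = λ _ → 0
    ; ranking-x = λ e _ e∈ → contradiction (e , e∈) none
    ; ranking-y = λ e _ e∈ → contradiction (e , e∈) none
    ; pre< = λ e e∈ → contradiction (e , e∈) none }
  rankings zero x y R #R≤0 | yes (e , e∈R) = contradiction e∈R (#-empty {R = R} #R≤0 e)
  rankings (suc b) x y R #R≤ | yes R≠∅ with peelable x y R R≠∅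
  ... | M , inj₁ pl = unpeel pl (rankings b x y (R ∖ M)
      (#-∖ {R = R} {M} (proj₁ nonempty) (M⊆R _ (proj₂ nonempty)) (proj₂ nonempty) #R≤))
    where open Peel pl
  ... | M , inj₂ pl = swap-rankings (unpeel pl (rankings b y x (R ∖ M)
      (#-∖ {R = R} {M} (proj₁ nonempty) (M⊆R _ (proj₂ nonempty)) (proj₂ nonempty) #R≤)))
    where open Peel pl

  abstract
    galvin : ∀ x y R (Λ : Fin m → List ℕ) → (∀ e → e ∈ R → Unique (Λ e)) →
             (∀ e → e ∈ R → deg x R (x e) ≤ length (Λ e)) →
             (∀ e → e ∈ R → deg y R (y e) ≤ length (Λ e)) →
             ∃ λ c → (∀ e → e ∈ R → c e ∈ˡ Λ e) × Proper x R c × Proper y R c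
    galvin x y R Λ uniq dx dy = colour-by-ranking x y p q _ R Λ ≤-refl ranking-x ranking-y uniq
      λ e e∈ → <-≤-trans (pre< e e∈) (⊔-lub (dx e e∈) (dy e e∈))
      where open Rankings (rankings _ x y R ≤-refl)

    -- Constant lists turn Galvin's theorem into König's. There is no circle, since the rankings
    -- come from matchings and not from a proper edge colouring.
    koenig : ∀ x y R d → (∀ v → deg x R v ≤ d) → (∀ v → deg y R v ≤ d) →
             ∃ λ c → (∀ e → e ∈ R → c e < d) × Proper x R c × Proper y R c
    koenig x y R d dx dy
      with c , c∈ , px , py ← galvin x y R (λ _ → upTo d) (λ _ _ → Uniqueₚ.upTo⁺ d)
             (λ e _ → ≤-trans (dx (x e)) (≤-reflexive (sym (Listₚ.length-upTo d))))
             (λ e _ → ≤-trans (dy (y e)) (≤-reflexive (sym (Listₚ.length-upTo d)))) =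
      c , (λ e e∈R → ∈-upTo⁻ (c∈ e e∈R)) , px , py

-- Balanced orientations

module Euler {m : ℕ} {V : Set} (_≟_ : DecidableEquality V) where
  open Sides {m} _≟_

  δ : V → V → ℕ
  δ w v with w ≟ v
  ... | yes _ = 1
  ... | no _ = 0

  deg-cong : ∀ {z z′} R v → (∀ f → f ∈ R → z f ≡ z′ f) → deg z R v ≡ deg z′ R v
  deg-cong R v eq = card-cong (λ f (f∈R , zf) → f∈R , trans (sym (eq f f∈R)) zf)
                              (λ f (f∈R , zf) → f∈R , trans (eq f f∈R) zf)

  deg-remove : ∀ z R e v → e ∈ R → deg z R v ≡ δ (z e) v + deg z (R ∖ singleton e) v
  deg-remove z R e v e∈R with z e ≟ v
  ... | no ze≢v = card-cong (λ { f (f∈R , zf) → (f∈R , λ { refl → ze≢v zf }) , zf })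
                            (λ f ((f∈R , _) , zf) → f∈R , zf)
  ... | yes ze≡v = ≤-antisym
    (≤-trans (card-∪ {P? = dec (singleton e)} {Q? = λ f → dec (R ∖ singleton e) f ×-dec (z f ≟ v)} here-or-not)
      (+-monoˡ-≤ _ (card-≤1 λ { f g refl refl → refl })))
    (card-< (λ f ((f∈R , _) , zf) → f∈R , zf) e (e∈R , ze≡v) λ ((_ , e≢e) , _) → e≢e refl)
    where
    here-or-not : ∀ f → f ∈ R × z f ≡ v → f ≡ e ⊎ (f ∈ R × f ≢ e) × z f ≡ v
    here-or-not f (f∈R , zf) with f Fin.≟ e
    ... | yes f≡e = inj₁ f≡e
    ... | no f≢e = inj₂ ((f∈R , f≢e) , zf)

  infixl 7 _[_↦_]

  _[_↦_] : (Fin m → V) → Fin m → V → Fin m → V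
  (z [ e ↦ w ]) f with f Fin.≟ e
  ... | yes _ = w
  ... | no _ = z f

  updated : ∀ z e w → (z [ e ↦ w ]) e ≡ w
  updated z e w with e Fin.≟ e
  ... | yes _ = refl
  ... | no e≢e = contradiction refl e≢e

  unchanged : ∀ z e w f → f ≢ e → (z [ e ↦ w ]) f ≡ z f
  unchanged z e w f f≢e with f Fin.≟ e
  ... | yes f≡e = contradiction f≡e f≢e
  ... | no _ = refl

  SameEnds : (u v u′ v′ : V) → Set
  SameEnds u v u′ v′ = (u′ ≡ u × v′ ≡ v) ⊎ (u′ ≡ v × v′ ≡ u)

  Balanced : (a b : Fin m → V) → DSet (Fin m) → Set
  Balanced a b R = ∀ v → deg a R v ≤ suc (deg b R v) × deg b R v ≤ suc (deg a R v)

  Orientation : (a b : Fin m → V) → DSet (Fin m) → Set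
  Orientation a b R = ∃ λ a′ → ∃ λ b′ → (∀ e → SameEnds (a e) (b e) (a′ e) (b′ e)) × Balanced a′ b′ R

  deg-update₂ : ∀ z R e f p r v → e ∈ R → f ∈ R → f ≢ e →
                deg (z [ e ↦ p ] [ f ↦ r ]) R v ≡ δ p v + (δ r v + deg z (R ∖ singleton e ∖ singleton f) v)
  deg-update₂ z R e f p r v e∈R f∈R f≢e = begin
    deg z″ R v                                  ≡⟨ deg-remove z″ R e v e∈R ⟩
    δ (z″ e) v + deg z″ (R ∖ singleton e) v
      ≡⟨ cong₂ _+_ (cong (λ w → δ w v) (trans (unchanged _ f r e (f≢e ∘ sym)) (updated z e p)))
           (deg-remove z″ (R ∖ singleton e) f v (f∈R , f≢e)) ⟩
    δ p v + (δ (z″ f) v + deg z″ R″ v)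
      ≡⟨ cong (δ p v +_) (cong₂ _+_ (cong (λ w → δ w v) (updated _ f r))
           (deg-cong {z″} {z} R″ v λ g ((_ , g≢e) , g≢f) →
              trans (unchanged _ f r g g≢f) (unchanged z e p g g≢e))) ⟩
    δ p v + (δ r v + deg z R″ v)                ∎
    where
    open ≡-Reasoning
    z″ = z [ e ↦ p ] [ f ↦ r ]
    R″ = R ∖ singleton e ∖ singleton f

  +-rotate : ∀ i j k → i + (j + k) ≡ j + (i + k)
  +-rotate = solve-∀

  -- The edges e = uv and f = vw are replaced by one edge uw, kept in the position of f; an
  -- orientation of uw is then pulled back to the path u, v, w.
  split-off : ∀ R (a b : Fin m → V) e f w → e ∈ R → f ∈ R → f ≢ e → SameEnds (a f) (b f) (b e) w →
              Orientation (a [ f ↦ a e ]) (b [ f ↦ w ]) (R ∖ singleton e) → Orientation a b R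
  split-off R a b e f w e∈R f∈R f≢e vw (a′ , b′ , same , bal) =
    pull (subst₂ (λ u w′ → SameEnds u w′ (a′ f) (b′ f)) (updated a f (a e)) (updated b f w) (same f))
    where
    R′ = R ∖ singleton e
    R″ = R′ ∖ singleton f
    v = b e
    deg-f : ∀ z p t → z f ≡ p → deg z R′ t ≡ δ p t + deg z R″ t
    deg-f z p t refl = deg-remove z R′ f t (f∈R , f≢e)
    -- Compared with the edge uw, the path through `v` adds one out-edge and one in-edge at `v` and
    -- changes nothing elsewhere.
    shift : ∀ (a″ b″ : Fin m → V) → (∀ t → deg a″ R t ≡ δ v t + deg a′ R′ t) →
            (∀ t → deg b″ R t ≡ δ v t + deg b′ R′ t) → Balanced a″ b″ R
    shift a″ b″ da db t rewrite da t | db t with out , inn ← bal t =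
      ≤-trans (+-monoʳ-≤ (δ v t) out) (≤-reflexive (+-suc _ _)) ,
      ≤-trans (+-monoʳ-≤ (δ v t) inn) (≤-reflexive (+-suc _ _))
    ends′ : ∀ p q r s → SameEnds (a e) v p q → SameEnds (a f) (b f) r s → ∀ g →
           SameEnds (a g) (b g) ((a′ [ e ↦ p ] [ f ↦ r ]) g) ((b′ [ e ↦ q ] [ f ↦ s ]) g)
    ends′ p q r s pq rs g with g Fin.≟ f
    ... | yes refl = rs
    ... | no g≢f with g Fin.≟ e
    ... | yes refl = pq
    ... | no g≢e = subst₂ (λ u w′ → SameEnds u w′ (a′ g) (b′ g))
      (unchanged a f (a e) g g≢f) (unchanged b f w g g≢f) (same g)
    pull : SameEnds (a e) w (a′ f) (b′ f) → Orientation a b R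
    pull (inj₁ (a′f , b′f)) = _ , _ , ends′ (a e) v v w (inj₁ (refl , refl)) vw , shift _ _
      (λ t → trans (deg-update₂ a′ R e f (a e) v t e∈R f∈R f≢e)
        (trans (+-rotate (δ (a e) t) (δ v t) _) (cong (δ v t +_) (sym (deg-f a′ (a e) t a′f)))))
      (λ t → trans (deg-update₂ b′ R e f v w t e∈R f∈R f≢e)
        (cong (δ v t +_) (sym (deg-f b′ w t b′f))))
    pull (inj₂ (a′f , b′f)) = _ , _ , ends′ v (a e) w v (inj₂ (refl , refl)) (flip-ends vw) , shift _ _
      (λ t → trans (deg-update₂ a′ R e f v w t e∈R f∈R f≢e)
        (cong (δ v t +_) (sym (deg-f a′ w t a′f))))
      (λ t → trans (deg-update₂ b′ R e f (a e) v t e∈R f∈R f≢e)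
        (trans (+-rotate (δ (a e) t) (δ v t) _) (cong (δ v t +_) (sym (deg-f b′ (a e) t b′f)))))
      where
      flip-ends : ∀ {u v u′ v′} → SameEnds u v u′ v′ → SameEnds u v v′ u′
      flip-ends (inj₁ (p , q)) = inj₂ (q , p)
      flip-ends (inj₂ (p , q)) = inj₁ (q , p)

  orient : ∀ n R a b → # R ≤ n → Orientation a b R
  orient n R a b #R≤n with any? (dec R)
  ... | no none = a , b , (λ _ → inj₁ (refl , refl)) , λ v → zero≤ a v , zero≤ b v
    where
    zero≤ : ∀ z v {n} → deg z R v ≤ n
    zero≤ z v = ≤-trans (≤-reflexive (card-none λ f (f∈R , _) → none (f , f∈R))) z≤n
  orient zero R a b #R≤0 | yes (e , e∈R) = contradiction e∈R (#-empty {R = R} #R≤0 e)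
  orient (suc n) R a b #R≤ | yes (e , e∈R)
    with any? (λ f → dec (R ∖ singleton e) f ×-dec ((a f ≟ b e) ⊎-dec (b f ≟ b e)))
  ... | yes (f , (f∈R , f≢e) , inj₁ af) =
    split-off R a b e f (b f) e∈R f∈R f≢e (inj₁ (sym af , refl))
      (orient n (R ∖ singleton e) _ _ (#-∖ {R = R} {singleton e} e e∈R refl #R≤))
  ... | yes (f , (f∈R , f≢e) , inj₂ bf) =
    split-off R a b e f (a f) e∈R f∈R f≢e (inj₂ (sym bf , refl))
      (orient n (R ∖ singleton e) _ _ (#-∖ {R = R} {singleton e} e e∈R refl #R≤))
  -- Now `e` is the only edge of `R` at `b e`, which is balanced either way, so the direction of `e`
  -- can be chosen to suit `a e`.
  ... | no pendant = choose (orient n R′ a b (#-∖ {R = R} {singleton e} e e∈R refl #R≤))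
    where
    R′ = R ∖ singleton e
    choose : Orientation a b R′ → Orientation a b R
    choose (a′ , b′ , same , bal) = [ forward , backward ]′ (≤-<-connex (deg a′ R′ (a e)) (deg b′ R′ (a e)))
      where
      at : ∀ {u v u′ v′ w} → SameEnds u v u′ v′ → u′ ≡ w ⊎ v′ ≡ w → u ≡ w ⊎ v ≡ w
      at (inj₁ (refl , refl)) = id
      at (inj₂ (refl , refl)) = Sum.swap
      none-at-v : ∀ {z} → (∀ f → z f ≡ b e → a′ f ≡ b e ⊎ b′ f ≡ b e) → deg z R′ (b e) ≡ 0
      none-at-v z-end = card-none λ f (f∈R′ , zf) → pendant (f , f∈R′ , at (same f) (z-end f zf))
      a′-none = none-at-v {a′} (λ _ → inj₁)
      b′-none = none-at-v {b′} (λ _ → inj₂)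
      ends′ : ∀ p q → SameEnds (a e) (b e) p q → ∀ g → SameEnds (a g) (b g) ((a′ [ e ↦ p ]) g) ((b′ [ e ↦ q ]) g)
      ends′ p q pq g with g Fin.≟ e
      ... | yes refl = pq
      ... | no _ = same g
      deg-e : ∀ z p t → deg (z [ e ↦ p ]) R t ≡ δ p t + deg z R′ t
      deg-e z p t = trans (deg-remove _ R e t e∈R) (cong₂ _+_ (cong (λ w → δ w t) (updated z e p))
        (deg-cong R′ t λ f (_ , f≢e) → unchanged z e p f f≢e))
      balance : ∀ {x y x′ y′ : ℕ} t → (t ≡ b e → x ≡ 0 × y ≡ 0) →
                (t ≡ a e → x ≤ y) → x ≤ suc y → y ≤ suc x →
                x′ ≡ δ (a e) t + x → y′ ≡ δ (b e) t + y → x′ ≤ suc y′ × y′ ≤ suc x′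
      balance {x} {y} t v u x≤ y≤ refl refl with b e ≟ t | a e ≟ t
      ... | yes refl | yes _ with refl , refl ← v refl = s≤s z≤n , s≤s z≤n
      ... | yes refl | no _ with refl , refl ← v refl = z≤n , ≤-refl
      ... | no _ | yes refl = s≤s (u refl) , m≤n⇒m≤1+n y≤
      ... | no _ | no _ = x≤ , y≤
      forward : deg a′ R′ (a e) ≤ deg b′ R′ (a e) → Orientation a b R
      forward le = _ , _ , ends′ (a e) (b e) (inj₁ (refl , refl)) , λ t →
        balance t (λ { refl → a′-none , b′-none }) (λ { refl → le }) (proj₁ (bal t)) (proj₂ (bal t))
          (deg-e a′ (a e) t) (deg-e b′ (b e) t)
      backward : deg b′ R′ (a e) < deg a′ R′ (a e) → Orientation a b R
      backward lt = _ , _ , ends′ (b e) (a e) (inj₂ (refl , refl)) , λ t → swap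
        (balance t (λ { refl → b′-none , a′-none }) (λ { refl → <⇒≤ lt }) (proj₂ (bal t)) (proj₁ (bal t))
          (deg-e b′ (a e) t) (deg-e a′ (b e) t))

-- Splitting a multigraph by degrees

module Degrees {m : ℕ} {V : Set} (_≟_ : DecidableEquality V)
               (a b : Fin m → V) (loopless : ∀ e → a e ≢ b e) where
  open Sides {m} _≟_
  open Peeling {m} _≟_

  Inc : Fin m → V → Set
  Inc e v = a e ≡ v ⊎ b e ≡ v

  inc? : ∀ e v → Dec (Inc e v)
  inc? e v = (a e ≟ v) ⊎-dec (b e ≟ v)

  degreeIn : DSet (Fin m) → V → ℕ
  degreeIn R v = card (λ e → dec R e ×-dec inc? e v)

  degree-⊆ : ∀ R S → R ⊆ S → ∀ v → degreeIn R v ≤ degreeIn S v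
  degree-⊆ R S R⊆S v = card-mono λ e (e∈R , i) → R⊆S e e∈R , i

  degree-∪ : ∀ R S v → degreeIn (R ∪ S) v ≤ degreeIn R v + degreeIn S v
  degree-∪ R S v = card-∪ λ { e (inj₁ e∈R , i) → inj₁ (e∈R , i) ; e (inj₂ e∈S , i) → inj₂ (e∈S , i) }

  degree-split : ∀ R S v → degreeIn R v + degreeIn (S ∖ R) v ≤ degreeIn (R ∪ S) v
  degree-split R S v = card-⊎ (λ e (e∈R , i) → inj₁ e∈R , i) (λ e ((e∈S , _) , i) → inj₂ e∈S , i)
    λ e (e∈R , _) ((_ , e∉R) , _) → e∉R e∈R

  module _ (s : ℕ) (D : DSet (Fin m)) (deg≤ : ∀ v → degreeIn D v ≤ suc s) where

    Full : V → Set
    Full v = degreeIn D v ≡ suc s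

    Touches : DSet (Fin m) → V → Set
    Touches M v = ∃ λ f → f ∈ M × Inc f v

    touches? : ∀ M v → Dec (Touches M v)
    touches? M v = any? (λ f → dec M f ×-dec inc? f v)

    Free : DSet (Fin m) → V → Set
    Free M v = Full v × ¬ Touches M v

    free? : ∀ M v → Dec (Free M v)
    free? M v = (degreeIn D v ℕ.≟ suc s) ×-dec ¬? (touches? M v)

    addable : DSet (Fin m) → DSet (Fin m)
    addable M = ⟨ (λ e → dec D e ×-dec (free? M (a e) ×-dec free? M (b e))) ⟩

    record FullMatching (M : DSet (Fin m)) : Set where
      field
        M⊆D : M ⊆ D
        full-ends : ∀ e v → e ∈ M → Inc e v → Full v
        disjoint : ∀ v e f → e ∈ M → f ∈ M → Inc e v → Inc f v → e ≡ f

    maximal-matching : ∀ n M → # (addable M) ≤ n → FullMatching M →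
                       ∃ λ M′ → FullMatching M′ × (∀ e → e ∉ addable M′)
    maximal-matching n M #≤n mat with any? (dec (addable M))
    ... | no none = M , mat , λ e e∈ → none (e , e∈)
    maximal-matching zero M #≤0 mat | yes (e , e∈) = contradiction e∈ (#-empty {R = addable M} #≤0 e)
    maximal-matching (suc n) M #≤ mat | yes (e , e∈D , ea@(ea-full , ¬ea) , eb@(eb-full , ¬eb)) =
      maximal-matching n M′ (s≤s⁻¹ (≤-trans
        (card-< (λ f (f∈D , fa , fb) → f∈D , weaken fa , weaken fb) e (e∈D , ea , eb)
          λ (_ , (_ , ¬ta) , _) → ¬ta (e , inj₂ refl , inj₁ refl)) #≤))
        record { M⊆D = λ { f (inj₁ f∈M) → M⊆D f f∈M ; f (inj₂ refl) → e∈D }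
               ; full-ends = λ { f v (inj₁ f∈M) i → full-ends f v f∈M i
                               ; f v (inj₂ refl) (inj₁ refl) → ea-full
                               ; f v (inj₂ refl) (inj₂ refl) → eb-full }
               ; disjoint = disjoint′ }
      where
      open FullMatching mat
      M′ = M ∪ singleton e
      weaken : ∀ {v} → Free M′ v → Free M v
      weaken (f , ¬t) = f , λ (g , g∈M , i) → ¬t (g , inj₁ g∈M , i)
      ¬touch : ∀ v f → f ∈ M → Inc e v → ¬ Inc f v
      ¬touch v f f∈M (inj₁ refl) i = ¬ea (f , f∈M , i)
      ¬touch v f f∈M (inj₂ refl) i = ¬eb (f , f∈M , i)
      disjoint′ : ∀ v f g → f ∈ M′ → g ∈ M′ → Inc f v → Inc g v → f ≡ g
      disjoint′ v f g (inj₁ f∈) (inj₁ g∈) i j = disjoint v f g f∈ g∈ i j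
      disjoint′ v f g (inj₁ f∈) (inj₂ refl) i j = contradiction i (¬touch v f f∈ j)
      disjoint′ v f g (inj₂ refl) (inj₁ g∈) i j = contradiction j (¬touch v g g∈ i)
      disjoint′ v f g (inj₂ refl) (inj₂ refl) i j = refl

    module Saturate (M : DSet (Fin m)) (mat : FullMatching M) (none : ∀ e → e ∉ addable M) where
      open FullMatching mat
      free : V → Set
      free = Free M
      R : DSet (Fin m)
      R = ⟨ (λ e → dec D e ×-dec (free? M (a e) ⊎-dec free? M (b e))) ⟩
      x y : Fin m → V
      x e with free? M (a e)
      ... | yes _ = a e
      ... | no _ = b e
      y e with free? M (a e)
      ... | yes _ = b e
      ... | no _ = a e
      x-inc : ∀ e → Inc e (x e)
      x-inc e with free? M (a e)
      ... | yes _ = inj₁ refl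
      ... | no _ = inj₂ refl
      y-inc : ∀ e → Inc e (y e)
      y-inc e with free? M (a e)
      ... | yes _ = inj₂ refl
      ... | no _ = inj₁ refl
      inc-xy : ∀ e v → Inc e v → x e ≡ v ⊎ y e ≡ v
      inc-xy e v i with free? M (a e)
      ... | yes _ = i
      ... | no _ = Sum.swap i
      x-free : ∀ e → e ∈ R → free (x e)
      x-free e (e∈D , fr) with free? M (a e) | fr
      ... | yes fa | _ = fa
      ... | no ¬fa | inj₁ fa = contradiction fa ¬fa
      ... | no ¬fa | inj₂ fb = fb
      y-not-free : ∀ e → e ∈ R → ¬ free (y e)
      y-not-free e (e∈D , fr) fy with free? M (a e)
      ... | yes fa = none e (e∈D , fa , fy)
      ... | no ¬fa = ¬fa fy
      deg-side : ∀ z → (∀ e → Inc e (z e)) → ∀ v → deg z R v ≤ suc s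
      deg-side z z-inc v = ≤-trans (card-mono λ e ((e∈D , _) , ze) → e∈D , subst (Inc e) ze (z-inc e)) (deg≤ v)
      module _ (c : Fin m → ℕ) (c≤s : ∀ e → e ∈ R → c e < suc s)
               (proper-x : Proper x R c) (proper-y : Proper y R c) where
        last : DSet (Fin m)
        last = ⟨ (λ e → dec R e ×-dec (c e ℕ.≟ s)) ⟩
        N = M ∪ last
        N⊆D : N ⊆ D
        N⊆D e (inj₁ e∈M) = M⊆D e e∈M
        N⊆D e (inj₂ ((e∈D , _) , _)) = e∈D
        free-edge : ∀ e v → e ∈ D → Inc e v → free v → e ∈ R × x e ≡ v
        free-edge e v e∈D i fv = e∈R , at-x (inc-xy e v i)
          where
          e∈R : e ∈ R
          e∈R = e∈D , Sum.map (λ { refl → fv }) (λ { refl → fv }) i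
          at-x : x e ≡ v ⊎ y e ≡ v → x e ≡ v
          at-x (inj₁ xe) = xe
          at-x (inj₂ refl) = contradiction fv (y-not-free e e∈R)
        -- All edges of `D` at a free vertex lie in `R` and have different colours; if colour `s` is
        -- missing, only `s` colours remain for them.
        few-colours : ∀ v → free v → ¬ Touches N v → degreeIn D v ≤ s
        few-colours v fv ¬t = card-injective s c below inj
          where
          below : ∀ e → e ∈ D × Inc e v → c e < s
          below e (e∈D , i) with e∈R , xe ← free-edge e v e∈D i fv =
            ≤∧≢⇒< (s≤s⁻¹ (c≤s e e∈R)) λ ce≡s → ¬t (e , inj₂ (e∈R , ce≡s) , i)
          inj : ∀ e f → e ∈ D × Inc e v → f ∈ D × Inc f v → c e ≡ c f → e ≡ f
          inj e f (e∈D , i) (f∈D , j) ce≡cf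
            with e∈R , xe ← free-edge e v e∈D i fv | f∈R , xf ← free-edge f v f∈D j fv =
            proper-x e f e∈R f∈R (trans xe (sym xf)) ce≡cf
        saturated : ∀ v → free v → Touches N v
        saturated v fv = [ id , (λ ¬t → contradiction (few-colours v fv ¬t) (<⇒≱ (≤-reflexive (sym (proj₁ fv))))) ]′
          (toSum (touches? N v))
        drop : ∀ v → Touches N v → degreeIn (D ∖ N) v < degreeIn D v
        drop v (e , e∈N , i) = card-< (λ f ((f∈D , _) , j) → f∈D , j) e (N⊆D e e∈N , i)
          λ ((_ , e∉N) , _) → e∉N e∈N
        deg-rest : ∀ v → degreeIn (D ∖ N) v ≤ s
        deg-rest v with degreeIn D v ℕ.≟ suc s | touches? M v
        ... | no ¬full | _ = ≤-trans (degree-⊆ (D ∖ N) D (λ _ → proj₁) v) (s≤s⁻¹ (≤∧≢⇒< (deg≤ v) ¬full))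
        ... | yes _ | yes (e , e∈M , i) = s≤s⁻¹ (≤-trans (drop v (e , inj₁ e∈M , i)) (deg≤ v))
        ... | yes fv | no ¬t = s≤s⁻¹ (≤-trans (drop v (saturated v (fv , ¬t))) (deg≤ v))
        M-deg : ∀ v → degreeIn M v ≤ 1
        M-deg v = card-≤1 λ e f (e∈M , i) (f∈M , j) → disjoint v e f e∈M f∈M i j
        last-deg-free : ∀ v → free v → degreeIn last v ≤ 1
        last-deg-free v fv = card-≤1 λ e f ((e∈R , ce) , i) ((f∈R , cf) , j) →
          proper-x e f e∈R f∈R (trans (proj₂ (free-edge e v (proj₁ e∈R) i fv))
                                 (sym (proj₂ (free-edge f v (proj₁ f∈R) j fv)))) (trans ce (sym cf))
        last-deg-¬free : ∀ v → ¬ free v → degreeIn last v ≤ 1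
        last-deg-¬free v ¬fv = card-≤1 λ e f ((e∈R , ce) , i) ((f∈R , cf) , j) →
          proper-y e f e∈R f∈R (trans (at-y e e∈R i) (sym (at-y f f∈R j))) (trans ce (sym cf))
          where
          at-y : ∀ e → e ∈ R → Inc e v → y e ≡ v
          at-y e e∈R i with inc-xy e v i
          ... | inj₁ refl = contradiction (x-free e e∈R) ¬fv
          ... | inj₂ ye = ye
        M-untouched : ∀ v → ¬ Touches M v → degreeIn M v ≡ 0
        M-untouched v ¬t = card-none λ e (e∈M , i) → ¬t (e , e∈M , i)
        last-deg : ∀ v → degreeIn last v ≤ 1
        last-deg v = [ last-deg-free v , last-deg-¬free v ]′ (toSum (free? M v))
        -- Degree 2 arises only where the colour class meets an edge of `M`, and both ends of such
        -- an edge are full. `partition` relies on this.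
        deg-N : ∀ v → degreeIn N v ≤ 1 ⊎ (Full v × degreeIn N v ≤ 2)
        deg-N v with touches? M v
        ... | yes (e , e∈M , i) = inj₂ (full-ends e v e∈M i ,
          ≤-trans (degree-∪ M last v) (+-mono-≤ (M-deg v) (last-deg v)))
        ... | no ¬t = inj₁ (≤-trans (degree-∪ M last v)
          (+-mono-≤ (≤-reflexive (M-untouched v ¬t)) (last-deg v)))

    -- Remove a maximal matching inside the set of vertices of degree s + 1. The vertices of this
    -- set that it misses are pairwise nonadjacent, so the edges at them form a bipartite graph;
    -- a colour class of an (s + 1)-edge-colouring of that graph saturates them and is removed too.
    abstract
      thin-out : ∃ λ N → N ⊆ D × (∀ v → degreeIn (D ∖ N) v ≤ s) ×
                         (∀ v → degreeIn N v ≤ 1 ⊎ (Full v × degreeIn N v ≤ 2))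
      thin-out
        with M , mat , none ← maximal-matching _ ∅ ≤-refl
               (record { M⊆D = λ _ () ; full-ends = λ _ _ () ; disjoint = λ _ _ _ () })
        with c , c≤s , px , py ← (let open Saturate M mat none in
               koenig x y R (suc s) (deg-side x x-inc) (deg-side y y-inc)) =
        let open Saturate M mat none in
        N c c≤s px py , N⊆D c c≤s px py , deg-rest c c≤s px py , deg-N c c≤s px py

  -- The two bounds add up to one more than the bound on the total, and this slack pays for
  -- `thin-out`: a vertex that loses two edges at once had the largest possible degree in the rest,
  -- so its degree in `H` was still one below its bound.
  partition : ∀ i s → (∀ v → degreeIn full v ≤ suc s + i) →
              ∃ λ H → (∀ v → degreeIn H v ≤ suc i) × (∀ v → degreeIn (full ∖ H) v ≤ suc s)
  partition zero s deg≤ = ∅ , (λ v → ≤-trans (≤-reflexive (card-none {P? = λ e → dec ∅ e ×-dec inc? e v} λ _ ())) z≤n) ,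
    λ v → ≤-trans (degree-⊆ (full ∖ ∅) full (λ _ → proj₁) v)
            (≤-trans (deg≤ v) (≤-reflexive (+-identityʳ _)))
  partition (suc i) s deg≤
    with H , H≤ , D≤ ← partition i (suc s) (λ v → ≤-trans (deg≤ v) (≤-reflexive (+-suc (suc s) i)))
    with N , N⊆D , rest , extra ← thin-out (suc s) (full ∖ H) D≤ =
    H ∪ N , H∪N≤ , λ v → ≤-trans (degree-⊆ (full ∖ (H ∪ N)) (full ∖ H ∖ N)
      (λ e (e∈ , e∉) → (e∈ , e∉ ∘ inj₁) , e∉ ∘ inj₂) v) (rest v)
    where
    H∪N≤ : ∀ v → degreeIn (H ∪ N) v ≤ suc (suc i)
    H∪N≤ v with extra v
    ... | inj₁ ≤1 = ≤-trans (degree-∪ H N v) (≤-trans (+-mono-≤ (H≤ v) ≤1) (≤-reflexive (+-comm _ 1)))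
    ... | inj₂ (fv , ≤2) = ≤-trans (degree-∪ H N v)
      (≤-trans (+-mono-≤ H≤i ≤2) (≤-reflexive (+-comm _ 2)))
      where
      open ≤-Reasoning
      H≤i : degreeIn H v ≤ i
      H≤i = +-cancelʳ-≤ (suc (suc s)) _ _ (begin
        degreeIn H v + suc (suc s)                  ≡⟨ cong (degreeIn H v +_) (sym fv) ⟩
        degreeIn H v + degreeIn (full ∖ H) v         ≤⟨ degree-split H full v ⟩
        degreeIn (H ∪ full) v                       ≤⟨ degree-⊆ (H ∪ full) full (λ _ _ → tt) v ⟩
        degreeIn full v                             ≤⟨ deg≤ v ⟩
        suc s + suc i                              ≡⟨ +-comm (suc s) (suc i) ⟩
        suc i + suc s                              ≡⟨ sym (+-suc i (suc s)) ⟩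
        i + suc (suc s)                            ∎)

-- Cutting the edges at a vertex into blocks

module Blocks {m : ℕ} {V : Set} (_≟_ : DecidableEquality V) (z : Fin m → V) (D : DSet (Fin m))
              (t : ℕ) .{{t≢0 : NonZero t}} where
  open Sides {m} _≟_

  _≟ⁿ_ : DecidableEquality (V × ℕ)
  _≟ⁿ_ = ×-≡-dec _≟_ ℕ._≟_

  index block : Fin m → ℕ
  index e = card (λ f → dec D f ×-dec ((z f ≟ z e) ×-dec (f Fin.<? e)))
  block e = index e / t

  node : Fin m → V × ℕ
  node e = z e , block e

  index<deg : ∀ e → e ∈ D → index e < deg z D (z e)
  index<deg e e∈D = card-< (λ f (f∈D , zf , _) → f∈D , zf) e (e∈D , refl)
    λ (_ , _ , e<e) → Finₚ.<-irrefl refl e<e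

  index-mono : ∀ e f → e ∈ D → z e ≡ z f → e Fin.< f → index e < index f
  index-mono e f e∈D ze≡zf e<f = card-< (λ g (g∈D , zg , g<e) → g∈D , trans zg ze≡zf , Finₚ.<-trans g<e e<f)
    e (e∈D , ze≡zf , e<f) λ (_ , _ , e<e) → Finₚ.<-irrefl refl e<e

  index-injective : ∀ e f → e ∈ D → f ∈ D → z e ≡ z f → index e ≡ index f → e ≡ f
  index-injective e f e∈D f∈D ze≡zf ie≡if with Finₚ.<-cmp e f
  ... | tri< e<f _ _ = contradiction ie≡if (<⇒≢ (index-mono e f e∈D ze≡zf e<f))
  ... | tri≈ _ e≡f _ = e≡f
  ... | tri> _ _ f<e = contradiction (sym ie≡if) (<⇒≢ (index-mono f e f∈D (sym ze≡zf) f<e))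

  -- Edges of the same block are told apart by their indices modulo `t`.
  block-size : ∀ w → card (λ e → dec D e ×-dec (node e ≟ⁿ w)) ≤ t
  block-size w = card-injective t (λ e → index e % t) (λ e _ → m%n<n (index e) t)
    λ { e f (e∈D , refl) (f∈D , nf) ie≡if → index-injective e f e∈D f∈D (sym (cong proj₁ nf))
        (trans (m≡m%n+[m/n]*n (index e) t) (trans (cong₂ (λ r q → r + q * t) ie≡if (sym (cong proj₂ nf)))
          (sym (m≡m%n+[m/n]*n (index f) t)))) }

  module _ (p : ℕ) where

    overflow : DSet (Fin m)
    overflow = ⟨ (λ e → dec D e ×-dec (p ≤? block e)) ⟩

    overflow-index : ∀ e → e ∈ overflow → p * t ≤ index e
    overflow-index e (_ , p≤) = ≤-trans (*-monoˡ-≤ t p≤) (m/n*n≤m (index e) t)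

    overflow-deg : ∀ e → e ∈ overflow → p * t < deg z D (z e)
    overflow-deg e e∈ = ≤-<-trans (overflow-index e e∈) (index<deg e (proj₁ e∈))

    -- With at most `p * t + 1` edges at the vertex, the only index beyond the first `p` blocks is
    -- `p * t`.
    overflow-unique : ∀ e f → e ∈ overflow → f ∈ overflow → z e ≡ z f → deg z D (z e) ≤ suc (p * t) → e ≡ f
    overflow-unique e f e∈ f∈ ze≡zf deg≤ = index-injective e f (proj₁ e∈) (proj₁ f∈) ze≡zf
      (trans (exact e e∈ deg≤) (sym (exact f f∈ (subst (λ v → deg z D v ≤ suc (p * t)) ze≡zf deg≤))))
      where
      exact : ∀ g → g ∈ overflow → deg z D (z g) ≤ suc (p * t) → index g ≡ p * t
      exact g g∈ ≤1+ = ≤-antisym (s≤s⁻¹ (≤-trans (index<deg g (proj₁ g∈)) ≤1+)) (overflow-index g g∈)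

-- Locally maximum cuts

module Cut {m n : ℕ} (a b : Fin m → Fin n) (loopless : ∀ e → a e ≢ b e) (H : DSet (Fin m)) where
  open Degrees Fin._≟_ a b loopless

  inner : (Fin n → Bool) → DSet (Fin m)
  inner χ = ⟨ (λ e → dec H e ×-dec (χ (a e) Boolₚ.≟ χ (b e))) ⟩

  flip-at : Fin n → (Fin n → Bool) → Fin n → Bool
  flip-at v χ w with w Fin.≟ v
  ... | yes _ = not (χ w)
  ... | no _ = χ w

  not-toggles : ∀ {x y} → not x ≡ y → x ≢ y
  not-toggles {false} refl ()
  not-toggles {true} refl ()

  flip-toggles : ∀ v χ e → Inc e v → e ∈ inner (flip-at v χ) → e ∉ inner χ
  flip-toggles v χ e i (_ , eq′) (_ , eq) with a e Fin.≟ v | b e Fin.≟ v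
  ... | yes ae | yes be = loopless e (trans ae (sym be))
  ... | yes _ | no _ = not-toggles eq′ eq
  ... | no _ | yes _ = not-toggles (sym eq′) (sym eq)
  ... | no ¬ae | no ¬be = [ ¬ae , ¬be ]′ i

  flip-keeps : ∀ v χ e → ¬ Inc e v → e ∈ inner (flip-at v χ) → e ∈ inner χ
  flip-keeps v χ e ¬i (e∈H , eq′) with a e Fin.≟ v | b e Fin.≟ v
  ... | yes ae | _ = contradiction (inj₁ ae) ¬i
  ... | no _ | yes be = contradiction (inj₂ be) ¬i
  ... | no _ | no _ = e∈H , eq′

  -- Local search: moving a vertex with more than half of its edges inside its part to the other
  -- part leaves fewer inner edges, and `k` bounds the number of moves.
  max-cut : ∀ k χ → # (inner χ) ≤ k →
            ∃ λ χ′ → ∀ v → degreeIn (inner χ′) v + degreeIn (inner χ′) v ≤ degreeIn H v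
  max-cut k χ #≤k with any? (λ v → degreeIn H v <? degreeIn (inner χ) v + degreeIn (inner χ) v)
  ... | no none = χ , λ v → ≮⇒≥ λ lt → none (v , lt)
  ... | yes (v , lt) = next k #≤k
    where
    open ≤-Reasoning
    I = inner χ
    I′ = inner (flip-at v χ)
    away? : ∀ e → Dec (e ∈ I × ¬ Inc e v)
    away? e = dec I e ×-dec ¬? (inc? e v)
    fewer-at-v : degreeIn (H ∖ I) v < degreeIn I v
    fewer-at-v = +-cancelˡ-< (degreeIn I v) _ _ (begin-strict
      degreeIn I v + degreeIn (H ∖ I) v   ≤⟨ degree-split I H v ⟩
      degreeIn (I ∪ H) v                 ≤⟨ degree-⊆ (I ∪ H) H (λ e → [ proj₁ , id ]′) v ⟩
      degreeIn H v                       <⟨ lt ⟩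
      degreeIn I v + degreeIn I v         ∎)
    split : ∀ e → e ∈ I′ → (e ∈ (H ∖ I) × Inc e v) ⊎ (e ∈ I × ¬ Inc e v)
    split e e∈ = [ (λ i → inj₁ ((proj₁ e∈ , flip-toggles v χ e i e∈) , i)) ,
                   (λ ¬i → inj₂ (flip-keeps v χ e ¬i e∈ , ¬i)) ]′ (toSum (inc? e v))
    decreases : # I′ < # I
    decreases = begin-strict
      # I′                              ≤⟨ card-∪ split ⟩
      degreeIn (H ∖ I) v + card away?    <⟨ +-monoˡ-< (card away?) fewer-at-v ⟩
      degreeIn I v + card away?          ≤⟨ card-⊎ (λ _ → proj₁) (λ _ → proj₁) (λ _ (_ , i) (_ , ¬i) → ¬i i) ⟩
      # I                               ∎
    next : ∀ k → # I ≤ k → _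
    next zero #≤0 = contradiction (<-≤-trans decreases #≤0) λ ()
    next (suc k) #≤ = max-cut k (flip-at v χ) (s≤s⁻¹ (<-≤-trans decreases #≤))

-- Greedy list colouring

module Greedy {m : ℕ} (_~_ : Fin m → Fin m → Set) (_~?_ : ∀ e f → Dec (e ~ f)) (L : Fin m → List ℕ)
              (uniq : ∀ e → Unique (L e)) (c₀ : Fin m → ℕ) where

  conflicts : Fin m → DSet (Fin m)
  conflicts e = ⟨ (λ f → ¬? (f Fin.≟ e) ×-dec (e ~? f)) ⟩

  -- Edges outside `I` keep their colours from `c₀` and are only ever looked at from edges of `I`,
  -- so conflicts have to be symmetric inside `I` only.
  extend-colouring : ∀ k I → # I ≤ k → (∀ e f → e ∈ I → f ∈ I → e ~ f → f ~ e) →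
    (∀ e → e ∈ I → # (conflicts e) < length (L e)) →
    ∃ λ c → (∀ f → f ∉ I → c f ≡ c₀ f) × (∀ e → e ∈ I → c e ∈ˡ L e) ×
            (∀ e f → e ∈ I → f ≢ e → e ~ f → c e ≢ c f)
  extend-colouring k I #≤k ~-sym room with any? (dec I)
  ... | no none = c₀ , (λ _ _ → refl) , (λ e e∈ → contradiction (e , e∈) none) ,
                  λ e _ e∈ → contradiction (e , e∈) none
  extend-colouring zero I #≤0 ~-sym room | yes (e , e∈I) = contradiction e∈I (#-empty {R = I} #≤0 e)
  extend-colouring (suc k) I #≤ ~-sym room | yes (e , e∈I) =
    add (extend-colouring k I′ (#-∖ {R = I} {singleton e} e e∈I refl #≤)
          (λ f g f∈ g∈ → ~-sym f g (proj₁ f∈) (proj₁ g∈)) (λ f f∈ → room f (proj₁ f∈)))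
    where
    I′ = I ∖ singleton e
    add : (∃ λ c → (∀ f → f ∉ I′ → c f ≡ c₀ f) × (∀ e → e ∈ I′ → c e ∈ˡ L e) ×
                   (∀ e f → e ∈ I′ → f ≢ e → e ~ f → c e ≢ c f)) → _
    add (c′ , off , c′∈ , apart) = pick (L′ , refl)
      where
      Taken : ℕ → Set
      Taken a = ∃ λ f → f ∈ conflicts e × c′ f ≡ a
      taken? : ∀ a → Dec (Taken a)
      taken? a = any? (λ f → dec (conflicts e) f ×-dec (c′ f ℕ.≟ a))
      L′ : List ℕ
      L′ = filter (λ a → ¬? (taken? a)) (L e)
      hit : ∀ a → ¬ ¬ Taken a → Taken a
      hit a ¬¬taken = [ id , (λ ¬taken → contradiction ¬taken ¬¬taken) ]′ (toSum (taken? a))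
      some-left : 0 < length L′
      some-left = +-cancelʳ-< (# (conflicts e)) _ _ (≤-trans (room e e∈I)
        (filter-length (λ a → ¬? (taken? a)) (conflicts e) c′ (uniq e) hit))
      pick : (∃ λ l → l ≡ L′) → _
      pick ([] , eq) = contradiction some-left (subst (λ l → ¬ 0 < length l) eq λ ())
      pick (α ∷ _ , eq) = c , off′ , c∈ , apart′
        where
        α∈L×free : α ∈ˡ L e × ¬ Taken α
        α∈L×free = ∈-filter⁻ (λ a → ¬? (taken? a)) (subst (α ∈ˡ_) eq (here refl))
        c : Fin m → ℕ
        c f with f Fin.≟ e
        ... | yes _ = α
        ... | no _ = c′ f
        off′ : ∀ f → f ∉ I → c f ≡ c₀ f
        off′ f f∉I with f Fin.≟ e
        ... | yes refl = contradiction e∈I f∉I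
        ... | no _ = off f (f∉I ∘ proj₁)
        c∈ : ∀ f → f ∈ I → c f ∈ˡ L f
        c∈ f f∈I with f Fin.≟ e
        ... | yes refl = proj₁ α∈L×free
        ... | no f≢e = c′∈ f (f∈I , f≢e)
        apart′ : ∀ f g → f ∈ I → g ≢ f → f ~ g → c f ≢ c g
        apart′ f g f∈I g≢f f~g cf≡cg with f Fin.≟ e | g Fin.≟ e
        ... | yes refl | yes refl = g≢f refl
        ... | yes refl | no g≢e = proj₂ α∈L×free (g , (g≢e , f~g) , sym cf≡cg)
        ... | no f≢e | no g≢e = apart f g (f∈I , f≢e) g≢f f~g cf≡cg
        ... | no f≢e | yes refl = proj₂ α∈L×free (f , (f≢e , ~-sym f e f∈I e∈I f~g) , cf≡cg)

-- The frugal list colouring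

-- Halving absorbs a surplus of one, which is the price of parity in the bounds below.
half-≤ : ∀ {i j} → i + i ≤ suc (j + j) → i ≤ j
half-≤ {i} {j} le = ≮⇒≥ λ j<i → contradiction (≤-trans (+-mono-≤ j<i j<i) le)
  (<⇒≱ (s≤s (≤-reflexive (sym (+-suc j j)))))

module Construction {m n : ℕ} (a b : Fin m → Fin n) (loopless : ∀ e → a e ≢ b e)
                    (p t d : ℕ) .{{t≢0 : NonZero t}} (3d≤2t : 3 * d ≤ 2 * t)
                    (L : Fin m → List ℕ) (uniq : ∀ e → Unique (L e)) (len : ∀ e → length (L e) ≡ t) where
  open Sides {m} {Fin n} Fin._≟_
  open Euler {m} {Fin n} Fin._≟_ using (SameEnds; Balanced; orient)
  open Degrees {m} {Fin n} Fin._≟_ a b loopless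

  d≤t : d ≤ t
  d≤t = half-≤ (m≤n⇒m≤1+n (begin
    d + d          ≤⟨ m≤m+n (d + d) d ⟩
    d + d + d      ≡⟨ lemma d ⟩
    3 * d          ≤⟨ 3d≤2t ⟩
    2 * t          ≡⟨ cong (t +_) (+-identityʳ t) ⟩
    t + t          ∎))
    where
    open ≤-Reasoning
    lemma : ∀ d → d + d + d ≡ 3 * d
    lemma = solve-∀

  -- The constant of Shannon's bound enters here: 2(d + σ) ≤ 3d + 1 ≤ 2t + 1.
  d+σ≤t : ∀ {σ} → σ + σ ≤ suc d → d + σ ≤ t
  d+σ≤t {σ} 2σ≤ = half-≤ (begin
    d + σ + (d + σ)     ≡⟨ lemma d σ ⟩
    d + d + (σ + σ)     ≤⟨ +-monoʳ-≤ (d + d) 2σ≤ ⟩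
    d + d + suc d       ≡⟨ lemma′ d ⟩
    suc (3 * d)         ≤⟨ s≤s 3d≤2t ⟩
    suc (2 * t)         ≡⟨ cong (λ u → suc (t + u)) (+-identityʳ t) ⟩
    suc (t + t)         ∎)
    where
    open ≤-Reasoning
    lemma : ∀ d σ → d + σ + (d + σ) ≡ d + d + (σ + σ)
    lemma = solve-∀
    lemma′ : ∀ d → d + d + suc d ≡ suc (3 * d)
    lemma′ = solve-∀

  Good : (Fin m → ℕ) → Set
  Good c = (∀ e → c e ∈ˡ L e) × (∀ v α → card (λ e → inc? e v ×-dec (c e ℕ.≟ α)) ≤ p + p + 1)

  module Decomposed
    (H : DSet (Fin m)) (H≤ : ∀ v → degreeIn H v ≤ d)
    (D≤ : ∀ v → degreeIn (full ∖ H) v ≤ suc (p * t + p * t))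
    (total : ∀ v → degreeIn full v ≤ p * t + p * t + d)
    (a′ b′ : Fin m → Fin n) (same : ∀ e → SameEnds (a e) (b e) (a′ e) (b′ e))
    (balanced : Balanced a′ b′ (full ∖ H))
    (χ : Fin n → Bool)
    (cut : ∀ v → degreeIn (Cut.inner a b loopless H χ) v + degreeIn (Cut.inner a b loopless H χ) v ≤ degreeIn H v)
    where
    D = full {Fin m} ∖ H
    module Out = Blocks {m} {Fin n} Fin._≟_ a′ D t
    module In = Blocks {m} {Fin n} Fin._≟_ b′ D t

    inc′ : ∀ e v → Inc e v → a′ e ≡ v ⊎ b′ e ≡ v
    inc′ e v with a′ e | b′ e | same e
    ... | _ | _ | inj₁ (refl , refl) = id
    ... | _ | _ | inj₂ (refl , refl) = Sum.swap

    inc-out : ∀ {e v} → a′ e ≡ v → Inc e v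
    inc-out {e} refl with a′ e | b′ e | same e
    ... | _ | _ | inj₁ (refl , refl) = inj₁ refl
    ... | _ | _ | inj₂ (refl , refl) = inj₂ refl

    inc-in : ∀ {e v} → b′ e ≡ v → Inc e v
    inc-in {e} refl with a′ e | b′ e | same e
    ... | _ | _ | inj₁ (refl , refl) = inj₂ refl
    ... | _ | _ | inj₂ (refl , refl) = inj₁ refl

    loopless′ : ∀ e → a′ e ≢ b′ e
    loopless′ e eq with a′ e | b′ e | same e
    ... | _ | _ | inj₁ (refl , refl) = loopless e eq
    ... | _ | _ | inj₂ (refl , refl) = loopless e (sym eq)

    out+in : ∀ v → deg a′ D v + deg b′ D v ≤ degreeIn D v
    out+in v = card-⊎ (λ e (e∈D , ae) → e∈D , inc-out ae) (λ e (e∈D , be) → e∈D , inc-in be)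
      λ e (_ , ae) (_ , be) → loopless′ e (trans ae (sym be))

    side≤ : ∀ {o i} → o + i ≤ suc (p * t + p * t) → o ≤ suc i → o ≤ suc (p * t)
    side≤ {o} {i} sum≤ o≤ = half-≤ (begin
      o + o                               ≤⟨ +-monoʳ-≤ o o≤ ⟩
      o + suc i                           ≡⟨ +-suc o i ⟩
      suc (o + i)                         ≤⟨ s≤s sum≤ ⟩
      suc (suc (p * t + p * t))           ≤⟨ s≤s (s≤s (+-monoʳ-≤ (p * t) (n≤1+n _))) ⟩
      suc (suc (p * t) + suc (p * t))     ∎)
      where open ≤-Reasoning

    out≤ : ∀ v → deg a′ D v ≤ suc (p * t)
    out≤ v = side≤ (≤-trans (out+in v) (D≤ v)) (proj₁ (balanced v))

    in≤ : ∀ v → deg b′ D v ≤ suc (p * t)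
    in≤ v = side≤ (≤-trans (≤-reflexive (+-comm (deg b′ D v) _)) (≤-trans (out+in v) (D≤ v))) (proj₂ (balanced v))

    -- A relation between edges and vertices, because an edge left over at `v` may lie in one of the
    -- first `p` blocks at its other end.
    Extra : Fin m → Fin n → Set
    Extra e v = (e ∈ Out.overflow p × a′ e ≡ v) ⊎ (e ∈ In.overflow p × b′ e ≡ v)

    extra? : ∀ e v → Dec (Extra e v)
    extra? e v = (dec (Out.overflow p) e ×-dec (a′ e Fin.≟ v)) ⊎-dec (dec (In.overflow p) e ×-dec (b′ e Fin.≟ v))

    -- Leftovers on both sides of `v` would force degree at least `2 * (p * t + 1)` in `D`, one more
    -- than allowed.
    not-both : ∀ v e f → e ∈ Out.overflow p → a′ e ≡ v → f ∈ In.overflow p → ¬ b′ f ≡ v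
    not-both v e f e∈ refl f∈ bf = contradiction
      (≤-trans (+-mono-≤ (Out.overflow-deg p e e∈)
                         (subst (λ w → p * t < deg b′ D w) bf (In.overflow-deg p f f∈)))
        (≤-trans (out+in v) (D≤ v)))
      (<⇒≱ (s≤s (≤-reflexive (sym (+-suc (p * t) (p * t))))))

    extra-unique : ∀ v e f → Extra e v → Extra f v → e ≡ f
    extra-unique v e f (inj₁ (e∈ , refl)) (inj₁ (f∈ , af)) = Out.overflow-unique p e f e∈ f∈ (sym af) (out≤ v)
    extra-unique v e f (inj₂ (e∈ , refl)) (inj₂ (f∈ , bf)) = In.overflow-unique p e f e∈ f∈ (sym bf) (in≤ v)
    extra-unique v e f (inj₁ (e∈ , ae)) (inj₂ (f∈ , bf)) = contradiction bf (not-both v e f e∈ ae f∈)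
    extra-unique v e f (inj₂ (e∈ , be)) (inj₁ (f∈ , af)) = contradiction be (not-both v f e f∈ af e∈)

    extras : Fin n → ℕ
    extras v = card (λ e → extra? e v)

    extras≤1 : ∀ v → extras v ≤ 1
    extras≤1 v = card-≤1 (extra-unique v)

    full-side : ∀ {o i} → p * t < o → o ≤ suc i → suc (p * t + p * t) ≤ o + i
    full-side pt<o o≤ = +-mono-≤ pt<o (s≤s⁻¹ (≤-trans pt<o o≤))

    -- If one side has more than `p * t` edges, balance gives the other at least `p * t`. Thus a
    -- leftover occurs only where `D` attains its degree bound.
    extra-deg : ∀ e v → Extra e v → suc (p * t + p * t) ≤ degreeIn D v
    extra-deg e v (inj₁ (e∈ , refl)) =
      ≤-trans (full-side (Out.overflow-deg p e e∈) (proj₁ (balanced v))) (out+in v)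
    extra-deg e v (inj₂ (e∈ , refl)) =
      ≤-trans (full-side (In.overflow-deg p e e∈) (proj₂ (balanced v)))
        (≤-trans (≤-reflexive (+-comm (deg b′ D v) _)) (out+in v))

    extras+H : ∀ v → extras v + degreeIn H v ≤ d
    extras+H v = [ with-extra , without-extra ]′ (toSum (any? (λ e → extra? e v)))
      where
      open ≤-Reasoning
      with-extra : (∃ λ e → Extra e v) → extras v + degreeIn H v ≤ d
      with-extra (e , ex) = +-cancelˡ-≤ (p * t + p * t) _ _ (begin
        p * t + p * t + (extras v + degreeIn H v)
          ≤⟨ +-monoʳ-≤ (p * t + p * t) (+-monoˡ-≤ (degreeIn H v) (extras≤1 v)) ⟩
        p * t + p * t + suc (degreeIn H v)         ≡⟨ +-suc (p * t + p * t) (degreeIn H v) ⟩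
        suc (p * t + p * t) + degreeIn H v         ≤⟨ +-monoˡ-≤ (degreeIn H v) (extra-deg e v ex) ⟩
        degreeIn D v + degreeIn H v                 ≡⟨ +-comm (degreeIn D v) _ ⟩
        degreeIn H v + degreeIn D v                 ≤⟨ degree-split H full v ⟩
        degreeIn (H ∪ full) v                      ≤⟨ degree-⊆ (H ∪ full) full (λ _ _ → tt) v ⟩
        degreeIn full v                            ≤⟨ total v ⟩
        p * t + p * t + d                         ∎)
      without-extra : ¬ (∃ λ e → Extra e v) → extras v + degreeIn H v ≤ d
      without-extra none = ≤-trans
        (≤-reflexive (cong (_+ degreeIn H v) (card-none λ e ex → none (e , ex)))) (H≤ v)

    I X : DSet (Fin m)
    I = Cut.inner a b loopless H χ
    X = H ∖ I

    -- The incidences whose colours have to be avoided by the edges of X.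
    Early : Fin m → Fin n → Set
    Early e v = Extra e v ⊎ (e ∈ I × Inc e v)

    early? : ∀ e v → Dec (Early e v)
    early? e v = extra? e v ⊎-dec (dec I e ×-dec inc? e v)

    σ : Fin n → ℕ
    σ v = card (λ e → early? e v)

    σ≤ : ∀ v → σ v ≤ extras v + degreeIn I v
    σ≤ v = card-∪ λ _ → id

    -- The inner edges counted twice are at most the edges of `H`, which together with the leftover
    -- number at most `d`; the surplus of one is the leftover counted a second time.
    2σ≤ : ∀ v → σ v + σ v ≤ suc d
    2σ≤ v = begin
      σ v + σ v                                             ≤⟨ +-mono-≤ (σ≤ v) (σ≤ v) ⟩
      extras v + degreeIn I v + (extras v + degreeIn I v)     ≡⟨ lemma (extras v) (degreeIn I v) ⟩
      extras v + (extras v + (degreeIn I v + degreeIn I v))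
        ≤⟨ +-mono-≤ (extras≤1 v) (≤-trans (+-monoʳ-≤ (extras v) (cut v)) (extras+H v)) ⟩
      suc d                                                 ∎
      where
      open ≤-Reasoning
      lemma : ∀ s i → s + i + (s + i) ≡ s + (s + (i + i))
      lemma = solve-∀

    X+σ≤d : ∀ v → degreeIn X v + σ v ≤ d
    X+σ≤d v = begin
      degreeIn X v + σ v                          ≤⟨ +-monoʳ-≤ (degreeIn X v) (σ≤ v) ⟩
      degreeIn X v + (extras v + degreeIn I v)     ≡⟨ lemma (degreeIn X v) (extras v) (degreeIn I v) ⟩
      extras v + (degreeIn I v + degreeIn X v)
        ≤⟨ +-monoʳ-≤ (extras v) (≤-trans (degree-split I H v) (degree-⊆ (I ∪ H) H (λ _ → [ proj₁ , id ]′) v)) ⟩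
      extras v + degreeIn H v                     ≤⟨ extras+H v ⟩
      d                                          ∎
      where
      open ≤-Reasoning
      lemma : ∀ x s i → x + (s + i) ≡ s + (i + x)
      lemma = solve-∀

    infix 4 _~_ _~?_

    -- An edge `f` of `D` that meets `e` within its first `p` blocks is no conflict for `e`. Hence
    -- the relation need not be symmetric unless both edges are in `I`.
    _~_ : Fin m → Fin m → Set
    e ~ f = Early f (a e) ⊎ Early f (b e)

    _~?_ : ∀ e f → Dec (e ~ f)
    e ~? f = early? f (a e) ⊎-dec early? f (b e)

    early-inc : ∀ {f v} → Early f v → Inc f v
    early-inc (inj₁ (inj₁ (_ , af))) = inc-out af
    early-inc (inj₁ (inj₂ (_ , bf))) = inc-in bf
    early-inc (inj₂ (_ , i)) = i

    ~-sym : ∀ e f → e ∈ I → f ∈ I → e ~ f → f ~ e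
    ~-sym e f e∈I f∈I e~f = [ meet (inj₁ refl) ∘ early-inc , meet (inj₂ refl) ∘ early-inc ]′ e~f
      where
      meet : ∀ {v} → Inc e v → Inc f v → f ~ e
      meet i (inj₁ refl) = inj₁ (inj₂ (e∈I , i))
      meet i (inj₂ refl) = inj₂ (inj₂ (e∈I , i))

    -- `e` itself is counted in `σ (a e)` and in `σ (b e)`, whose sum is at most `d + 1`. Without
    -- it, fewer than `d` conflicts remain.
    inner-room : ∀ e → e ∈ I → card (λ f → ¬? (f Fin.≟ e) ×-dec (e ~? f)) < length (L e)
    inner-room e e∈I = begin-strict
      card (λ f → ¬? (f Fin.≟ e) ×-dec (e ~? f))   ≤⟨ card-∪ split ⟩
      card (rest? (a e)) + card (rest? (b e))      <⟨ s≤s⁻¹ both ⟩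
      d                                            ≤⟨ d≤t ⟩
      t                                            ≡⟨ sym (len e) ⟩
      length (L e)                                 ∎
      where
      open ≤-Reasoning
      rest? : ∀ v f → Dec (f ≢ e × Early f v)
      rest? v f = ¬? (f Fin.≟ e) ×-dec early? f v
      split : ∀ f → f ≢ e × e ~ f → (f ≢ e × Early f (a e)) ⊎ (f ≢ e × Early f (b e))
      split f (f≢e , r) = Sum.map (f≢e ,_) (f≢e ,_) r
      rest< : ∀ v → Inc e v → card (rest? v) < σ v
      rest< v i = card-< (λ _ → proj₂) e (inj₂ (e∈I , i)) λ (e≢e , _) → e≢e refl
      σσ≤ : σ (a e) + σ (b e) ≤ suc d
      σσ≤ = half-≤ (begin
        σ (a e) + σ (b e) + (σ (a e) + σ (b e))     ≡⟨ lemma (σ (a e)) (σ (b e)) ⟩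
        σ (a e) + σ (a e) + (σ (b e) + σ (b e))     ≤⟨ +-mono-≤ (2σ≤ (a e)) (2σ≤ (b e)) ⟩
        suc d + suc d                               ≤⟨ n≤1+n _ ⟩
        suc (suc d + suc d)                         ∎)
        where
        lemma : ∀ x y → x + y + (x + y) ≡ x + x + (y + y)
        lemma = solve-∀
      both : suc (suc (card (rest? (a e)) + card (rest? (b e)))) ≤ suc d
      both = begin
        suc (suc (card (rest? (a e)) + card (rest? (b e))))
          ≡⟨ cong suc (sym (+-suc _ _)) ⟩
        suc (card (rest? (a e))) + suc (card (rest? (b e)))
          ≤⟨ +-mono-≤ (rest< (a e) (inj₁ refl)) (rest< (b e) (inj₂ refl)) ⟩
        σ (a e) + σ (b e)                           ≤⟨ σσ≤ ⟩
        suc d                                       ∎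

    x y : Fin m → Fin n
    x e = if χ (a e) then a e else b e
    y e = if χ (a e) then b e else a e

    x-inc : ∀ e → Inc e (x e)
    x-inc e with χ (a e)
    ... | true = inj₁ refl
    ... | false = inj₂ refl

    y-inc : ∀ e → Inc e (y e)
    y-inc e with χ (a e)
    ... | true = inj₂ refl
    ... | false = inj₁ refl

    side : ∀ e v → e ∈ X → Inc e v → (χ v ≡ true × x e ≡ v) ⊎ (χ v ≡ false × y e ≡ v)
    side e v (e∈H , e∉I) i with χ (a e) in χa | χ (b e) in χb | i
    ... | true | true | _ = ⊥-elim (e∉I (e∈H , refl))
    ... | false | false | _ = ⊥-elim (e∉I (e∈H , refl))
    ... | true | false | inj₁ refl = inj₁ (χa , refl)
    ... | true | false | inj₂ refl = inj₂ (χb , refl)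
    ... | false | true | inj₁ refl = inj₂ (χa , refl)
    ... | false | true | inj₂ refl = inj₁ (χb , refl)

    module OuterColoured (c₀ : Fin m → ℕ) (c₀∈ : ∀ e → e ∈ D → c₀ e ∈ˡ L e)
                         (proper-out : ∀ e f → e ∈ D → f ∈ D → Out.node e ≡ Out.node f → c₀ e ≡ c₀ f → e ≡ f)
                         (proper-in : ∀ e f → e ∈ D → f ∈ D → In.node e ≡ In.node f → c₀ e ≡ c₀ f → e ≡ f)
                         (c₁ : Fin m → ℕ) (c₁≡c₀ : ∀ f → f ∉ I → c₁ f ≡ c₀ f)
                         (c₁∈ : ∀ e → e ∈ I → c₁ e ∈ˡ L e)
                         (apart : ∀ e f → e ∈ I → f ≢ e → e ~ f → c₁ e ≢ c₁ f) where

      Taken : Fin m → ℕ → Set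
      Taken e α = ∃ λ f → (Early f (x e) ⊎ Early f (y e)) × c₁ f ≡ α

      taken? : ∀ e α → Dec (Taken e α)
      taken? e α = any? (λ f → (early? f (x e) ⊎-dec early? f (y e)) ×-dec (c₁ f ℕ.≟ α))

      Λ : Fin m → List ℕ
      Λ e = filter (λ α → ¬? (taken? e α)) (L e)

      Λ-unique : ∀ e → Unique (Λ e)
      Λ-unique e = Uniqueₚ.filter⁺ (λ α → ¬? (taken? e α)) (uniq e)

      blockers : Fin m → DSet (Fin m)
      blockers e = ⟨ (λ f → early? f (x e) ⊎-dec early? f (y e)) ⟩

      t≤ : ∀ e → t ≤ length (Λ e) + # (blockers e)
      t≤ e = subst (_≤ length (Λ e) + # (blockers e)) (len e)
        (filter-length (λ α → ¬? (taken? e α)) (blockers e) c₁ (uniq e) hit)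
        where
        hit : ∀ α → ¬ ¬ Taken e α → Taken e α
        hit α ¬¬t = [ id , (λ ¬t → contradiction ¬t ¬¬t) ]′ (toSum (taken? e α))

      -- At least t - σ(v) - σ(w) colours survive, and t - σ(w) ≥ d while d - σ(v) bounds the degree
      -- of `v` in `X`. These are the local list sizes for Galvin's theorem.
      Λ-length : ∀ e v w → # (blockers e) ≤ σ v + σ w → degreeIn X v ≤ length (Λ e)
      Λ-length e v w ≤σσ = +-cancelʳ-≤ (# (blockers e)) _ _ (begin
        degreeIn X v + # (blockers e)       ≤⟨ +-monoʳ-≤ (degreeIn X v) ≤σσ ⟩
        degreeIn X v + (σ v + σ w)          ≡⟨ sym (+-assoc (degreeIn X v) (σ v) (σ w)) ⟩
        degreeIn X v + σ v + σ w            ≤⟨ +-monoˡ-≤ (σ w) (X+σ≤d v) ⟩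
        d + σ w                            ≤⟨ d+σ≤t (2σ≤ w) ⟩
        t                                  ≤⟨ t≤ e ⟩
        length (Λ e) + # (blockers e)      ∎)
        where open ≤-Reasoning

      deg-x≤ : ∀ e → deg x X (x e) ≤ length (Λ e)
      deg-x≤ e = ≤-trans (card-mono λ f (f∈X , xf) → f∈X , subst (Inc f) xf (x-inc f))
        (Λ-length e (x e) (y e) (card-∪ λ _ → id))

      deg-y≤ : ∀ e → deg y X (y e) ≤ length (Λ e)
      deg-y≤ e = ≤-trans (card-mono λ f (f∈X , yf) → f∈X , subst (Inc f) yf (y-inc f))
        (Λ-length e (y e) (x e) (card-∪ λ _ → Sum.swap))

      module CutColoured (c₂ : Fin m → ℕ) (c₂∈ : ∀ e → e ∈ X → c₂ e ∈ˡ Λ e)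
                         (proper-x : Proper x X c₂) (proper-y : Proper y X c₂) where

        c : Fin m → ℕ
        c e with dec X e
        ... | yes _ = c₂ e
        ... | no _ = c₁ e

        c-X : ∀ e → e ∈ X → c e ≡ c₂ e
        c-X e e∈X with dec X e
        ... | yes _ = refl
        ... | no e∉X = contradiction e∈X e∉X

        c-¬X : ∀ e → e ∉ X → c e ≡ c₁ e
        c-¬X e e∉X with dec X e
        ... | yes e∈X = contradiction e∈X e∉X
        ... | no _ = refl

        c-D : ∀ e → e ∈ D → c e ≡ c₀ e
        c-D e (_ , e∉H) = trans (c-¬X e (e∉H ∘ proj₁)) (c₁≡c₀ e (e∉H ∘ proj₁))

        kinds : ∀ e → e ∈ D ⊎ e ∈ I ⊎ e ∈ X
        kinds e with dec H e | dec I e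
        ... | no e∉H | _ = inj₁ (tt , e∉H)
        ... | yes _ | yes e∈I = inj₂ (inj₁ e∈I)
        ... | yes e∈H | no e∉I = inj₂ (inj₂ (e∈H , e∉I))

        c₂-avoids : ∀ e → e ∈ X → c₂ e ∈ˡ L e × ¬ Taken e (c₂ e)
        c₂-avoids e e∈X = ∈-filter⁻ (λ α → ¬? (taken? e α)) (c₂∈ e e∈X)

        c∈L : ∀ e → c e ∈ˡ L e
        c∈L e = by (kinds e)
          where
          by : e ∈ D ⊎ e ∈ I ⊎ e ∈ X → c e ∈ˡ L e
          by (inj₁ e∈D) = subst (_∈ˡ L e) (sym (c-D e e∈D)) (c₀∈ e e∈D)
          by (inj₂ (inj₁ e∈I)) = subst (_∈ˡ L e) (sym (c-¬X e λ e∈X → proj₂ e∈X e∈I)) (c₁∈ e e∈I)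
          by (inj₂ (inj₂ e∈X)) = subst (_∈ˡ L e) (sym (c-X e e∈X)) (proj₁ (c₂-avoids e e∈X))

        early-∉X : ∀ e v → Early e v → e ∉ X
        early-∉X e v (inj₁ (inj₁ (((_ , e∉H) , _) , _))) (e∈H , _) = e∉H e∈H
        early-∉X e v (inj₁ (inj₂ (((_ , e∉H) , _) , _))) (e∈H , _) = e∉H e∈H
        early-∉X e v (inj₂ (e∈I , _)) (_ , e∉I) = e∉I e∈I

        Special : Fin n → Fin m → Set
        Special v e = Early e v ⊎ (e ∈ X × Inc e v)

        special? : ∀ v e → Dec (Special v e)
        special? v e = early? e v ⊎-dec (dec X e ×-dec inc? e v)

        early-early : ∀ v e f → Early e v → Early f v → f ≢ e → c e ≢ c f
        early-early v e f ee ef f≢e ce≡cf = go ee ef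
          where
          c₁≡ : c₁ e ≡ c₁ f
          c₁≡ = trans (sym (c-¬X e (early-∉X e v ee))) (trans ce≡cf (c-¬X f (early-∉X f v ef)))
          at : ∀ {g h} → Inc g v → Early h v → g ~ h
          at (inj₁ refl) eh = inj₁ eh
          at (inj₂ refl) eh = inj₂ eh
          go : Early e v → Early f v → ⊥
          go (inj₁ xe) (inj₁ xf) = f≢e (sym (extra-unique v e f xe xf))
          go (inj₂ (e∈I , i)) ef = apart e f e∈I f≢e (at i ef) c₁≡
          go ee (inj₂ (f∈I , i)) = apart f e f∈I (f≢e ∘ sym) (at i ee) (sym c₁≡)

        early-cut : ∀ v e f → Early e v → f ∈ X → Inc f v → c e ≢ c f
        early-cut v e f ee f∈X i ce≡cf = proj₂ (c₂-avoids f f∈X)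
          (e , near (side f v f∈X i) , trans (sym (c-¬X e (early-∉X e v ee))) (trans ce≡cf (c-X f f∈X)))
          where
          near : (χ v ≡ true × x f ≡ v) ⊎ (χ v ≡ false × y f ≡ v) → Early e (x f) ⊎ Early e (y f)
          near (inj₁ (_ , refl)) = inj₁ ee
          near (inj₂ (_ , refl)) = inj₂ ee

        cut-cut : ∀ v e f → e ∈ X → Inc e v → f ∈ X → Inc f v → c e ≡ c f → e ≡ f
        cut-cut v e f e∈X i f∈X j ce≡cf = go (side e v e∈X i) (side f v f∈X j)
          where
          c₂≡ : c₂ e ≡ c₂ f
          c₂≡ = trans (sym (c-X e e∈X)) (trans ce≡cf (c-X f f∈X))
          go : (χ v ≡ true × x e ≡ v) ⊎ (χ v ≡ false × y e ≡ v) →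
               (χ v ≡ true × x f ≡ v) ⊎ (χ v ≡ false × y f ≡ v) → e ≡ f
          go (inj₁ (_ , xe)) (inj₁ (_ , xf)) = proper-x e f e∈X f∈X (trans xe (sym xf)) c₂≡
          go (inj₂ (_ , ye)) (inj₂ (_ , yf)) = proper-y e f e∈X f∈X (trans ye (sym yf)) c₂≡
          go (inj₁ (χt , _)) (inj₂ (χf , _)) = contradiction (trans (sym χt) χf) λ ()
          go (inj₂ (χf , _)) (inj₁ (χt , _)) = contradiction (trans (sym χt) χf) λ ()

        special-proper : ∀ v e f → Special v e → Special v f → c e ≡ c f → e ≡ f
        special-proper v e f (inj₂ (e∈X , i)) (inj₂ (f∈X , j)) eq = cut-cut v e f e∈X i f∈X j eq
        special-proper v e f (inj₁ ee) (inj₂ (f∈X , j)) eq = contradiction eq (early-cut v e f ee f∈X j)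
        special-proper v e f (inj₂ (e∈X , i)) (inj₁ ef) eq = contradiction (sym eq) (early-cut v f e ef e∈X i)
        special-proper v e f (inj₁ ee) (inj₁ ef) eq =
          [ sym , (λ f≢e → contradiction eq (early-early v e f ee ef f≢e)) ]′ (toSum (f Fin.≟ e))

        module _ (v : Fin n) (α : ℕ) where

          special-α? : ∀ e → Dec (Special v e × c e ≡ α)
          special-α? e = special? v e ×-dec (c e ℕ.≟ α)

          out-α? : ∀ e → Dec ((e ∈ D × a′ e ≡ v × Out.block e < p) × c e ≡ α)
          out-α? e = (dec D e ×-dec ((a′ e Fin.≟ v) ×-dec (Out.block e <? p))) ×-dec (c e ℕ.≟ α)

          in-α? : ∀ e → Dec ((e ∈ D × b′ e ≡ v × In.block e < p) × c e ≡ α)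
          in-α? e = (dec D e ×-dec ((b′ e Fin.≟ v) ×-dec (In.block e <? p))) ×-dec (c e ℕ.≟ α)

          special-count : card special-α? ≤ 1
          special-count = card-≤1 λ e f (se , ce) (sf , cf) → special-proper v e f se sf (trans ce (sym cf))

          out-count : card out-α? ≤ p
          -- Each of the first `p` blocks at `v` is a single node and contains the colour at most
          -- once.
          out-count = ≤-trans (card-fibres {κ = 1} p Out.block (λ e ((_ , _ , lt) , _) → lt)
            λ k → card-≤1 λ e f (((e∈D , ae , _) , ce) , be) (((f∈D , af , _) , cf) , bf) →
              proper-out e f e∈D f∈D (cong₂ _,_ (trans ae (sym af)) (trans be (sym bf)))
                (trans (sym (c-D e e∈D)) (trans ce (trans (sym cf) (c-D f f∈D)))))
            (≤-reflexive (*-identityʳ p))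

          in-count : card in-α? ≤ p
          in-count = ≤-trans (card-fibres {κ = 1} p In.block (λ e ((_ , _ , lt) , _) → lt)
            λ k → card-≤1 λ e f (((e∈D , ae , _) , ce) , be) (((f∈D , af , _) , cf) , bf) →
              proper-in e f e∈D f∈D (cong₂ _,_ (trans ae (sym af)) (trans be (sym bf)))
                (trans (sym (c-D e e∈D)) (trans ce (trans (sym cf) (c-D f f∈D)))))
            (≤-reflexive (*-identityʳ p))

          classify : ∀ e → Inc e v → Special v e ⊎
                     ((e ∈ D × a′ e ≡ v × Out.block e < p) ⊎ (e ∈ D × b′ e ≡ v × In.block e < p))
          classify e i = by (kinds e)
            where
            by : e ∈ D ⊎ e ∈ I ⊎ e ∈ X → _
            by (inj₂ (inj₁ e∈I)) = inj₁ (inj₁ (inj₂ (e∈I , i)))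
            by (inj₂ (inj₂ e∈X)) = inj₁ (inj₂ (e∈X , i))
            by (inj₁ e∈D) with inc′ e v i
            ... | inj₁ ae = [ (λ lt → inj₂ (inj₁ (e∈D , ae , lt))) ,
                              (λ ge → inj₁ (inj₁ (inj₁ (inj₁ ((e∈D , ge) , ae))))) ]′ (<-≤-connex (Out.block e) p)
            ... | inj₂ be = [ (λ lt → inj₂ (inj₂ (e∈D , be , lt))) ,
                              (λ ge → inj₁ (inj₁ (inj₁ (inj₂ ((e∈D , ge) , be))))) ]′ (<-≤-connex (In.block e) p)

          colour-count : card (λ e → inc? e v ×-dec (c e ℕ.≟ α)) ≤ p + p + 1
          colour-count = begin
            card (λ e → inc? e v ×-dec (c e ℕ.≟ α))
              ≤⟨ card-∪ {P? = special-α?} {Q? = λ e → out-α? e ⊎-dec in-α? e} split ⟩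
            card special-α? + card (λ e → out-α? e ⊎-dec in-α? e)
              ≤⟨ +-mono-≤ special-count (≤-trans (card-∪ {P? = out-α?} {Q? = in-α?} λ _ → id)
                   (+-mono-≤ out-count in-count)) ⟩
            1 + (p + p)                    ≡⟨ +-comm 1 (p + p) ⟩
            p + p + 1                      ∎
            where
            open ≤-Reasoning
            split : ∀ e → Inc e v × c e ≡ α → (Special v e × c e ≡ α) ⊎
                    (((e ∈ D × a′ e ≡ v × Out.block e < p) × c e ≡ α) ⊎
                     ((e ∈ D × b′ e ≡ v × In.block e < p) × c e ≡ α))
            split e (i , ce) = Sum.map (_, ce) (Sum.map (_, ce) (_, ce)) (classify e i)

        good : Good c
        good = c∈L , colour-count

      colour-cut : ∃ Good
      colour-cut = finish (galvin x y X Λ (λ e _ → Λ-unique e) (λ e _ → deg-x≤ e) (λ e _ → deg-y≤ e))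
        where
        open Peeling {m} {Fin n} Fin._≟_ using (galvin)
        finish : (∃ λ c₂ → (∀ e → e ∈ X → c₂ e ∈ˡ Λ e) × Proper x X c₂ × Proper y X c₂) → ∃ Good
        finish (c₂ , c₂∈ , px , py) = _ , CutColoured.good c₂ c₂∈ px py

    colour-outer : ∃ Good
    -- All of `D` is coloured here, leftovers included: they sit at nodes with block number at least
    -- `p`.
    colour-outer = inside (galvin Out.node In.node D L (λ e _ → uniq e)
        (λ e _ → ≤-trans (Out.block-size (Out.node e)) (≤-reflexive (sym (len e))))
        (λ e _ → ≤-trans (In.block-size (In.node e)) (≤-reflexive (sym (len e)))))
      where
      open Peeling {m} {Fin n × ℕ} Out._≟ⁿ_ using (galvin)
      inside : (∃ λ c₀ → (∀ e → e ∈ D → c₀ e ∈ˡ L e) ×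
                 (∀ e f → e ∈ D → f ∈ D → Out.node e ≡ Out.node f → c₀ e ≡ c₀ f → e ≡ f) ×
                 (∀ e f → e ∈ D → f ∈ D → In.node e ≡ In.node f → c₀ e ≡ c₀ f → e ≡ f)) → ∃ Good
      inside (c₀ , c₀∈ , po , pi) = then (extend-colouring _ I ≤-refl ~-sym inner-room)
        where
        open Greedy _~_ _~?_ L uniq c₀
        then : (∃ λ c → (∀ f → f ∉ I → c f ≡ c₀ f) × (∀ e → e ∈ I → c e ∈ˡ L e) ×
                 (∀ e f → e ∈ I → f ≢ e → e ~ f → c e ≢ c f)) → ∃ Good
        then (c₁ , off , c₁∈ , apart) = OuterColoured.colour-cut c₀ c₀∈ po pi c₁ off c₁∈ apart

  split-degrees : (∀ v → degreeIn full v ≤ p * t + p * t + d) →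
                  ∃ λ H → (∀ v → degreeIn H v ≤ d) × (∀ v → degreeIn (full ∖ H) v ≤ suc (p * t + p * t))
  split-degrees total = by d refl
    where
    by : ∀ d′ → d′ ≡ d → ∃ λ H → (∀ v → degreeIn H v ≤ d) × (∀ v → degreeIn (full ∖ H) v ≤ suc (p * t + p * t))
    -- `partition` bounds the degrees in `H` by a positive number only; for `d = 0` the whole
    -- multigraph already satisfies the bound for `D`.
    by zero refl = ∅ , (λ v → ≤-reflexive (card-none {P? = λ e → dec ∅ e ×-dec inc? e v} λ _ ())) ,
      λ v → ≤-trans (degree-⊆ (full ∖ ∅) full (λ _ → proj₁) v)
        (m≤n⇒m≤1+n (≤-trans (total v) (≤-reflexive (+-identityʳ _))))
    by (suc i) refl = partition i (p * t + p * t) λ v → ≤-trans (total v) (≤-reflexive (+-suc _ i))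

  frugal-colouring : (∀ v → degreeIn full v ≤ p * t + p * t + d) → ∃ Good
  frugal-colouring total = from (split-degrees total)
    where
    from : (∃ λ H → (∀ v → degreeIn H v ≤ d) × (∀ v → degreeIn (full ∖ H) v ≤ suc (p * t + p * t))) → ∃ Good
    from (H , H≤ , D≤) = oriented (orient _ (full ∖ H) a b ≤-refl) (Cut.max-cut a b loopless H _ (λ _ → true) ≤-refl)
      where
      oriented : (∃ λ a′ → ∃ λ b′ → (∀ e → SameEnds (a e) (b e) (a′ e) (b′ e)) × Balanced a′ b′ (full ∖ H)) →
                 (∃ λ χ → ∀ v → degreeIn (Cut.inner a b loopless H χ) v + degreeIn (Cut.inner a b loopless H χ) v
                                 ≤ degreeIn H v) → ∃ Good
      oriented (a′ , b′ , same , bal) (χ , cut) =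
        Decomposed.colour-outer H H≤ D≤ total a′ b′ same bal χ cut

-- Decidability of the colouring properties

-- The functions are enumerated by codes in a finite type. Decoding a code returns the function only
-- pointwise, so the property has to respect pointwise equality.
∀-functions? : ∀ {m n} {P : (Fin m → Fin n) → Set} → (∀ f → Dec (P f)) →
               (∀ {f g} → (∀ i → f i ≡ g i) → P f → P g) → Dec (∀ f → P f)
∀-functions? P? resp = map′ (λ all f → resp (Finₚ.finToFun-funToFin f) (all (Fin.funToFin f)))
  (λ all i → all (Fin.finToFun i)) (all? (λ i → P? (Fin.finToFun i)))

∃-function? : ∀ {m n} {P : (Fin m → Fin n) → Set} → (∀ f → Dec (P f)) →
              (∀ {f g} → (∀ i → f i ≡ g i) → P f → P g) → Dec (∃ P)
∃-function? P? resp = map′ (λ (i , p) → Fin.finToFun i , p)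
  (λ (f , p) → Fin.funToFin f , resp (λ i → sym (Finₚ.finToFun-funToFin f i)) p)
  (any? (λ i → P? (Fin.finToFun i)))

lookup-unique : ∀ {xs : List ℕ} → Unique xs → ∀ i j → lookup xs i ≡ lookup xs j → i ≡ j
lookup-unique (_ ∷ _) zero zero _ = refl
lookup-unique (x∉ ∷ _) zero (suc j) eq = contradiction eq (All.lookup x∉ (∈-lookup j))
lookup-unique (x∉ ∷ _) (suc i) zero eq = contradiction (sym eq) (All.lookup x∉ (∈-lookup i))
lookup-unique (_ ∷ uniq) (suc i) (suc j) eq = cong suc (lookup-unique uniq i j eq)

least : (P : ℕ → Set) → (∀ n → Dec (P n)) → ∀ b → P b → ∃ λ n → P n × (∀ j → P j → n ≤ j) × n ≤ b
least P P? b Pb = search b 0 (+-identityʳ b) λ _ _ → z≤n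
  where
  search : ∀ k i → k + i ≡ b → (∀ j → P j → i ≤ j) → ∃ λ n → P n × (∀ j → P j → n ≤ j) × n ≤ b
  search k i k+i≡b below with P? i
  ... | yes Pi = i , Pi , below , ≤-trans (m≤n+m i k) (≤-reflexive k+i≡b)
  search zero i refl below | no ¬Pi = contradiction Pb ¬Pi
  search (suc k) i k+i≡b below | no ¬Pi = search k (suc i) (trans (+-suc k i) k+i≡b)
    λ j Pj → ≤∧≢⇒< (below j Pj) λ { refl → ¬Pi Pj }

module _ (G : Multigraph) where

  colourDegree-mono : ∀ {C C′ : Set} (_≟₁_ : DecidableEquality C) (_≟₂_ : DecidableEquality C′)
                      (c : Fin (m G) → C) (c′ : Fin (m G) → C′) v α β →
                      (∀ e → c e ≡ α → c′ e ≡ β) → colourDegree G _≟₁_ c v α ≤ colourDegree G _≟₂_ c′ v β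
  colourDegree-mono _≟₁_ _≟₂_ c c′ v α β imp = begin
    colourDegree G _≟₁_ c v α                                 ≡⟨ sym (card≡count _) ⟩
    card (λ e → incident? G e v ×-dec (c e ≟₁ α))             ≤⟨ card-mono (λ e (i , ce) → i , imp e ce) ⟩
    card (λ e → incident? G e v ×-dec (c′ e ≟₂ β))            ≡⟨ card≡count _ ⟩
    colourDegree G _≟₂_ c′ v β                                ∎
    where open ≤-Reasoning

  frugal-resp : ∀ {k} {C : Set} (_≟₁_ : DecidableEquality C) {c c′ : Fin (m G) → C} →
                (∀ e → c e ≡ c′ e) → Frugal G k _≟₁_ c → Frugal G k _≟₁_ c′
  frugal-resp _≟₁_ {c} {c′} eq fr v α =
    ≤-trans (colourDegree-mono _≟₁_ _≟₁_ c′ c v α α λ e ce → trans (eq e) ce) (fr v α)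

  frugal? : ∀ k {N} (c : Fin (m G) → Fin N) → Dec (Frugal G k Fin._≟_ c)
  frugal? k c = all? (λ v → all? (λ α → colourDegree G Fin._≟_ c v α ≤? k))

  colourable? : ∀ k t → Dec (Colourable G k t)
  colourable? k t = ∃-function? (frugal? k) (frugal-resp Fin._≟_)

  module _ (k t : ℕ) where

    Distinct : ∀ {N} → (Fin t → Fin N) → Set
    Distinct ℓ = ∀ i j → ℓ i ≡ ℓ j → i ≡ j

    Choosable : ∀ {N} → (Fin (m G) → Fin t → Fin N) → Set
    Choosable ℓ = ∃ λ (s : Fin (m G) → Fin t) → Frugal G k Fin._≟_ (λ e → ℓ e (s e))

    -- Lists without repetition become injections into a finite palette, which leaves finitely many
    -- list assignments to check.
    BoundedListColourable : ℕ → Set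
    BoundedListColourable N = ∀ (ℓ : Fin (m G) → Fin t → Fin N) → (∀ e → Distinct (ℓ e)) → Choosable ℓ

    bounded? : ∀ N → Dec (BoundedListColourable N)
    bounded? N = map′
      (λ all ℓ → resp (λ e → Finₚ.finToFun-funToFin (ℓ e)) (all (λ e → Fin.funToFin (ℓ e))))
      (λ all g → all (decode g))
      (∀-functions? (λ g → good? (decode g))
        λ eq → resp λ e i → cong (λ h → Fin.finToFun h i) (eq e))
      where
      Goodℓ : (Fin (m G) → Fin t → Fin N) → Set
      Goodℓ ℓ = (∀ e → Distinct (ℓ e)) → Choosable ℓ
      decode : (Fin (m G) → Fin (N ^ t)) → Fin (m G) → Fin t → Fin N
      decode g e = Fin.finToFun (g e)
      good? : ∀ ℓ → Dec (Goodℓ ℓ)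
      good? ℓ = all? (λ e → all? (λ i → all? (λ j → (ℓ e i Fin.≟ ℓ e j) →-dec (i Fin.≟ j)))) →-dec
        ∃-function? (λ s → frugal? k (λ e → ℓ e (s e)))
          (λ eq → frugal-resp Fin._≟_ λ e → cong (ℓ e) (eq e))
      resp : ∀ {ℓ ℓ′} → (∀ e i → ℓ e i ≡ ℓ′ e i) → Goodℓ ℓ → Goodℓ ℓ′
      resp eq good distinct
        with s , fr ← good (λ e i j p → distinct e i j (trans (sym (eq e i)) (trans p (eq e j)))) =
        s , frugal-resp Fin._≟_ (λ e → eq e (s e)) fr

    list⇒bounded : ∀ N → ListColourable G k t → BoundedListColourable N
    list⇒bounded N lc ℓ distinct = s , λ v α → ≤-trans
        (colourDegree-mono Fin._≟_ ℕ._≟_ (λ e → ℓ e (s e)) c v α (toℕ α)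
          λ e eq → trans (proj₂ (chosen e)) (cong toℕ eq))
        (fr v (toℕ α))
      where
      L : Fin (m G) → List ℕ
      L e = tabulate (toℕ ∘ ℓ e)
      col = lc L (λ e → Listₚ.length-tabulate (toℕ ∘ ℓ e))
              (λ e → Uniqueₚ.tabulate⁺ λ {i} {j} eq → distinct e i j (Finₚ.toℕ-injective eq))
      c = proj₁ col
      fr = proj₂ (proj₂ col)
      chosen : ∀ e → ∃ λ i → c e ≡ toℕ (ℓ e i)
      chosen e = ∈-tabulate⁻ (proj₁ (proj₂ col) e)
      s : Fin (m G) → Fin t
      s e = proj₁ (chosen e)

    -- At most m t colours occur in the lists, and they can be renamed to positions in the lists.
    bounded⇒list : BoundedListColourable (suc (m G * t)) → ListColourable G k t
    bounded⇒list bl L len uniq = choose (bl (λ e i → rename (ℓ e i)) distinct)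
      where
      position : ∀ e → Fin t → Fin (length (L e))
      position e = Fin.cast (sym (len e))
      ℓ : Fin (m G) → Fin t → ℕ
      ℓ e i = lookup (L e) (position e i)
      at : Fin (m G * t) → ℕ
      at z = ℓ (proj₁ (Fin.remQuot {m G} t z)) (proj₂ (Fin.remQuot {m G} t z))
      rename : ℕ → Fin (suc (m G * t))
      rename α with any? (λ z → at z ℕ.≟ α)
      ... | yes (z , _) = suc z
      -- The colour `zero` stands for everything outside the lists and accounts for the `suc` in the
      -- size of the palette.
      ... | no _ = zero
      original : Fin (suc (m G * t)) → ℕ
      original zero = 0
      original (suc z) = at z
      original-rename : ∀ e i → original (rename (ℓ e i)) ≡ ℓ e i
      original-rename e i with any? (λ z → at z ℕ.≟ ℓ e i)
      ... | yes (z , eq) = eq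
      ... | no none = contradiction
        (Fin.combine e i , cong (λ ei → ℓ (proj₁ ei) (proj₂ ei)) (Finₚ.remQuot-combine e i)) none
      distinct : ∀ e → Distinct (λ i → rename (ℓ e i))
      distinct e i j eq = Finₚ.toℕ-injective (trans (sym (Finₚ.toℕ-cast (sym (len e)) i))
        (trans (cong toℕ (lookup-unique (uniq e) (position e i) (position e j)
          (trans (sym (original-rename e i)) (trans (cong original eq) (original-rename e j)))))
        (Finₚ.toℕ-cast (sym (len e)) j)))
      choose : Choosable (λ e i → rename (ℓ e i)) → _
      choose (s , fr) = (λ e → ℓ e (s e)) , (λ e → ∈-lookup (position e (s e))) , λ v α → ≤-trans
        (colourDegree-mono ℕ._≟_ Fin._≟_ (λ e → ℓ e (s e)) (λ e → rename (ℓ e (s e))) v α (rename α)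
          λ e → cong rename)
        (fr v (rename α))

    listColourable? : Dec (ListColourable G k t)
    listColourable? = map′ bounded⇒list (list⇒bounded (suc (m G * t))) (bounded? (suc (m G * t)))

    list⇒colourable : ListColourable G k t → Colourable G k t
    list⇒colourable lc
      with c , c∈ , fr ← lc (λ _ → upTo t) (λ _ → Listₚ.length-upTo t) (λ _ → Uniqueₚ.upTo⁺ t) =
      c′ , λ v α → ≤-trans
        (colourDegree-mono Fin._≟_ ℕ._≟_ c′ c v α (toℕ α)
          λ e eq → trans (sym (Finₚ.toℕ-fromℕ< (∈-upTo⁻ (c∈ e)))) (cong toℕ eq))
        (fr v (toℕ α))
      where
      c′ : Fin (m G) → Fin t
      c′ e = Fin.fromℕ< (∈-upTo⁻ (c∈ e))

-- Ceilings and the two bounds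

⌈/⌉-upper : ∀ a b .{{_ : NonZero b}} → a ≤ ⌈ a / b ⌉ * b
⌈/⌉-upper a b@(suc b′) = s≤s⁻¹ (+-cancelʳ-≤ b′ _ _ (begin
  suc a + b′                     ≡⟨ sym (+-suc a b′) ⟩
  a + b                          ≡⟨ sym (m+n∸n≡m (a + b) 1) ⟩
  a + b + 1 ∸ 1                  ≡⟨ cong (_∸ 1) (+-comm (a + b) 1) ⟩
  a + b                          ≡⟨ +-suc a b′ ⟩
  suc (a + b′)                   ≡⟨ cong suc (sym a+b∸1) ⟩
  suc (a + b ∸ 1)                ≡⟨ cong suc (m≡m%n+[m/n]*n (a + b ∸ 1) b) ⟩
  suc ((a + b ∸ 1) % b + q * b)  ≤⟨ s≤s (+-monoˡ-≤ (q * b) (s≤s⁻¹ (m%n<n (a + b ∸ 1) b))) ⟩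
  suc (b′ + q * b)               ≡⟨ cong suc (+-comm b′ (q * b)) ⟩
  suc (q * b) + b′               ∎))
  where
  open ≤-Reasoning
  q = ⌈ a / b ⌉
  a+b∸1 : a + b ∸ 1 ≡ a + b′
  a+b∸1 = cong (_∸ 1) (+-suc a b′)

⌈/⌉-least : ∀ {a b q} .{{_ : NonZero b}} → a ≤ q * b → ⌈ a / b ⌉ ≤ q
⌈/⌉-least {a} {b@(suc b′)} {q} a≤ = s≤s⁻¹ (m<n*o⇒m/o<n {a + b ∸ 1} {suc q} {b} (begin-strict
  a + b ∸ 1        ≡⟨ cong (_∸ 1) (+-suc a b′) ⟩
  a + b′           <⟨ +-mono-≤-< a≤ (n<1+n b′) ⟩
  q * b + b        ≡⟨ +-comm (q * b) b ⟩
  suc q * b        ∎))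
  where open ≤-Reasoning

maxFin-least : ∀ {n b} (f : Fin n → ℕ) → (∀ i → f i ≤ b) → maxFin f ≤ b
maxFin-least {zero} f f≤ = z≤n
maxFin-least {suc n} f f≤ = ⊔-lub (f≤ zero) (maxFin-least (f ∘ suc) (f≤ ∘ suc))

degree≤Δ : ∀ G v → card (λ e → incident? G e v) ≤ Δ G
degree≤Δ G v = ≤-trans (≤-reflexive (card≡count _)) (≤-maxFin (degree G) v)

-- Each of the `χ` colours accounts for at most `k` of the edges at a vertex.
Δ≤colours : ∀ G k χ → Colourable G k χ → Δ G ≤ χ * k
Δ≤colours G k χ (c , fr) = maxFin-least (degree G) λ v → ≤-trans
  (≤-reflexive (sym (card≡count _))) (card-fibres χ (toℕ ∘ c) (λ e _ → Finₚ.toℕ<n (c e)) (fibre v))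
  where
  fibre : ∀ v α → card (λ e → incident? G e v ×-dec (toℕ (c e) ℕ.≟ α)) ≤ k
  fibre v α with α <? χ
  ... | no α≮χ = ≤-trans (≤-reflexive (card-none λ { e (_ , refl) → α≮χ (Finₚ.toℕ<n (c e)) })) z≤n
  ... | yes α<χ = ≤-trans (card-mono λ e (i , eq) → i ,
      Finₚ.toℕ-injective (trans eq (sym (Finₚ.toℕ-fromℕ< α<χ))))
    (≤-trans (≤-reflexive (card≡count (λ e → incident? G e v ×-dec (c e Fin.≟ Fin.fromℕ< α<χ)))) (fr v _))

list-bound : ∀ G p t → 3 * Δ G ≤ t * (6 * p + 2) → ListColourable G (p + p + 1) t
-- Blocks of size `t` need `t` to be nonzero; for `t = 0` the maximum degree is 0 and there are no
-- edges.
list-bound G p zero 3Δ≤ L len uniq = (λ _ → 0) , (λ e → contradiction e edgeless) ,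
  λ v α → ≤-trans (≤-reflexive (trans (sym (card≡count _)) (card-none λ e _ → edgeless e))) z≤n
  where
  edgeless : ¬ Fin (m G)
  edgeless e = contradiction
    (≤-trans (card-pos {P? = λ f → incident? G f (proj₁ (ends G e))} e (inj₁ refl))
      (≤-trans (degree≤Δ G _) (≤-trans (m≤m+n (Δ G) _) 3Δ≤))) λ ()
list-bound G p t@(suc _) 3Δ≤ L len uniq = convert (frugal-colouring total)
  where
  P = p * t + p * t
  -- Truncated subtraction: below `P` the value 0 still gives both `3 * d ≤ 2 * t` and
  -- `Δ G ≤ P + d`.
  d = Δ G ∸ P
  3d≤2t : 3 * d ≤ 2 * t
  3d≤2t with ≤-total (Δ G) P
  ... | inj₁ Δ≤P rewrite m≤n⇒m∸n≡0 Δ≤P = z≤n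
  ... | inj₂ P≤Δ = +-cancelˡ-≤ (3 * P) _ _ (begin
    3 * P + 3 * d           ≡⟨ sym (*-distribˡ-+ 3 P d) ⟩
    3 * (P + d)             ≡⟨ cong (3 *_) (m+[n∸m]≡n P≤Δ) ⟩
    3 * Δ G                 ≤⟨ 3Δ≤ ⟩
    t * (6 * p + 2)         ≡⟨ lemma t p ⟩
    3 * P + 2 * t           ∎)
    where
    open ≤-Reasoning
    lemma : ∀ t p → t * (6 * p + 2) ≡ 3 * (p * t + p * t) + 2 * t
    lemma = solve-∀
  a b : Fin (m G) → Fin (n G)
  a e = proj₁ (ends G e)
  b e = proj₂ (ends G e)
  open Construction a b (loopless G) p t d 3d≤2t L uniq len using (Good; frugal-colouring)
  open Degrees Fin._≟_ a b (loopless G) using (degreeIn)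
  Δ≤P+d : Δ G ≤ P + d
  Δ≤P+d = [ (λ Δ≤P → ≤-trans Δ≤P (m≤m+n P d)) , (λ P≤Δ → ≤-reflexive (sym (m+[n∸m]≡n P≤Δ))) ]′
    (≤-total (Δ G) P)
  total : ∀ v → degreeIn full v ≤ P + d
  total v = ≤-trans (card-mono λ _ → proj₂) (≤-trans (degree≤Δ G v) Δ≤P+d)
  convert : ∃ Good → Σ (Fin (m G) → ℕ) λ c → (∀ e → c e ∈ˡ L e) × Frugal G (p + p + 1) ℕ._≟_ c
  convert (c , c∈ , few) = c , c∈ , λ v α → ≤-trans (≤-reflexive (sym (card≡count _))) (few v α)

odd : ∀ k → k % 2 ≡ 1 → k ≡ k / 2 + k / 2 + 1
odd k k%2≡1 = trans (m≡m%n+[m/n]*n k 2) (trans (cong (_+ k / 2 * 2) k%2≡1) (lemma (k / 2)))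
  where
  lemma : ∀ p → 1 + p * 2 ≡ p + p + 1
  lemma = solve-∀

theorem18 : (k : ℕ) → .{{_ : NonZero k}} → k % 2 ≡ 1 → (G : Multigraph) →
    Σ ℕ λ χ → Σ ℕ λ ch →
    IsChromaticIndexₖ G k χ × IsChoiceIndexₖ G k ch ×
    ⌈ Δ G / k ⌉ ≤ χ × χ ≤ ch × ch ≤ ⌈ 3 * Δ G / suc (3 * k ∸ 2) ⌉
-- The search for the choice index stops at `t` and the one for the chromatic index at the choice
-- index, which gives the last two inequalities.
theorem18 k k%2≡1 G = result (least (ListColourable G k) (listColourable? G k) t list-t)
  where
  p = k / 2
  t = ⌈ 3 * Δ G / suc (3 * k ∸ 2) ⌉
  -- The denominator 3k - 1, written as a successor to be visibly nonzero; k = 2p + 1 makes it 6p +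
  -- 2.
  divisor : suc (3 * k ∸ 2) ≡ 6 * p + 2
  divisor = trans (cong (λ j → suc (3 * j ∸ 2)) (odd k k%2≡1))
    (trans (cong (λ j → suc (j ∸ 2)) (lemma p)) (+-comm 2 (6 * p)))
    where
    lemma : ∀ p → 3 * (p + p + 1) ≡ 3 + 6 * p
    lemma = solve-∀
  list-t : ListColourable G k t
  list-t = subst (λ j → ListColourable G j t) (sym (odd k k%2≡1)) (list-bound G p t
    (≤-trans (⌈/⌉-upper (3 * Δ G) (suc (3 * k ∸ 2))) (≤-reflexive (cong (t *_) divisor))))
  result : (∃ λ ch → ListColourable G k ch × (∀ j → ListColourable G k j → ch ≤ j) × ch ≤ t) → _
  result (ch , list-ch , ch-least , ch≤t) = finish
    (least (Colourable G k) (colourable? G k) ch (list⇒colourable G k ch list-ch))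
    where
    finish : (∃ λ χ → Colourable G k χ × (∀ j → Colourable G k j → χ ≤ j) × χ ≤ ch) → _
    finish (χ , col , χ-least , χ≤ch) = χ , ch , (col , χ-least) , (list-ch , ch-least) ,
      ⌈/⌉-least (Δ≤colours G k χ col) , χ≤ch , ch≤t
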